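{- For every integer $n\geq 1$, $$T(4,n) = G_n(4,1) + 10\,G_{n-1}(4,0) + 4\,G_{n-2}(5,0).$$
   Context: The Super-Catalan numbers are $T(m,n) := \frac{1}{2}\cdot\frac{(2m)!\,(2n)!}{m!\,n!\,(m+n)!}$ for integers $m\ge 0$, $n\geq 1$. A Dyck path of length $2\ell$ ($\ell\ge 0$) is a sequence $\pi=(\pi(1),\dots,\pi(2\ell))$ with each $\pi(k)=\pm1$, $\sum_{i=1}^{2\ell}\pi(i)=0$, and $\sum_{i=1}^k\pi(i)\ge 0$ for all $1\le k\le 2\ell$; its length is $|\pi|=2\ell$. Its height is $h(\pi)=\max_k\sum_{i=1}^k\pi(i)$, and the unique Dyck path $\epsilon$ of length $0$ has $h(\epsilon)=0$. For integers $m\ge 1$, $k\ge 0$ and $n$, $G_n(m,k)$ is the number of $m$-tuples $(\pi^{(1)},\dots,\pi^{(m)})$ of Dyck paths with $\sum_{i=1}^m|\pi^{(i)}|=2n$ and $|h(\pi^{(i)})-h(\pi^{(j)})|\le k$ for all $i,j$ (so $G_n(m,k)=0$ for $n<0$). -}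

module Defs where

open import Data.Fin.Base using (Fin)
import Data.Fin.Properties as Fin
open import Data.Integer.Base as ℤ using (ℤ; +_; 0ℤ; 1ℤ; ∣_∣)
import Data.Integer.Properties as ℤ
open import Data.List.Base
  using (List; []; _∷_; map; foldr; length; inits; filter; cartesianProductWith)
import Data.List.Properties as List
open import Data.List.Membership.Propositional using (_∈_; _∉_)
open import Data.List.Membership.Propositional.Properties
  using (∈-cartesianProductWith⁺; ∈-cartesianProductWith⁻; ∈-filter⁺; ∈-filter⁻)
open import Data.List.Relation.Unary.All as All using (All)
open import Data.List.Relation.Unary.AllPairs using ([]; _∷_)
open import Data.List.Relation.Unary.Any using (here; there)
open import Data.List.Relation.Unary.Unique.Propositional using (Unique)
import Data.List.Relation.Unary.Unique.Propositional.Properties as Unique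
open import Data.Nat.Base as ℕ using (ℕ; zero; suc; _≤_; z≤n; s≤s; _!)
import Data.Nat.Properties as ℕ
open import Data.Product.Base using (_×_; _,_; proj₂)
open import Data.Rational.Base as ℚ using (ℚ; ½)
open import Data.Sign.Base as Sign using (Sign)
open import Data.Vec.Base as Vec using (Vec; []; _∷_; lookup)
import Data.Vec.Properties as Vec
open import Data.Vec.Relation.Unary.All as VecAll using ([]; _∷_)
open import Function.Base using (_∘_)
open import Function.Bundles using (_⇔_; mk⇔)
open import Relation.Binary.PropositionalEquality
  using (_≡_; refl; cong)
open import Relation.Nullary.Decidable using (_×-dec_)
open import Relation.Unary using (Decidable)

T : ℕ → ℕ → ℚ
T m n = ½ ℚ.* (+ ((2 ℕ.* m) ! ℕ.* (2 ℕ.* n) !) ℚ./ (m ! ℕ.* n ! ℕ.* (m ℕ.+ n) !))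
  where instance
    _ = ℕ.m*n≢0 (m ! ℕ.* n !) ((m ℕ.+ n) !)
          {{ℕ.m*n≢0 (m !) (n !) {{m ℕ.!≢0}} {{n ℕ.!≢0}}}} {{(m ℕ.+ n) ℕ.!≢0}}

-- Sign.+ is the step +1 and Sign.- the step -1.
Path : Set
Path = List Sign

total : Path → ℤ
total = foldr ℤ._+_ 0ℤ ∘ map (ℤ._◃ 1)

-- The empty prefix, with sum 0, is included.
partialSums : Path → List ℤ
partialSums = map total ∘ inits

-- The length is not required to be even: this follows from total π ≡ 0.
IsDyck : Path → Set
IsDyck π = total π ≡ 0ℤ × All (0ℤ ℤ.≤_) (partialSums π)

isDyck? : Decidable IsDyck
isDyck? π = (total π ℤ.≟ 0ℤ) ×-dec All.all? (0ℤ ℤ.≤?_) (partialSums π)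

-- On Dyck paths the starting value 0 of the maximum only matters for the
-- empty path: every other Dyck path has the partial sum 0 at its end.
height : Path → ℤ
height = foldr ℤ._⊔_ 0ℤ ∘ partialSums

Admissible : (n : ℤ) (m k : ℕ) → Vec Path m → Set
Admissible n m k πs
  = VecAll.All IsDyck πs
  × + Vec.sum (Vec.map length πs) ≡ + 2 ℤ.* n
  × (∀ i j → ∣ height (lookup πs i) ℤ.- height (lookup πs j) ∣ ≤ k)

admissible? : ∀ n m k → Decidable (Admissible n m k)
admissible? n m k πs
  = VecAll.all? isDyck? πs
  ×-dec (+ Vec.sum (Vec.map length πs) ℤ.≟ + 2 ℤ.* n)
  ×-dec Fin.all? λ i → Fin.all? λ j →
          ∣ height (lookup πs i) ℤ.- height (lookup πs j) ∣ ℕ.≤? k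

signs : List Sign
signs = Sign.+ ∷ Sign.- ∷ []

-- All paths, Dyck or not, of length at most l.
pathsUpTo : ℕ → List Path
pathsUpTo zero    = [] ∷ []
pathsUpTo (suc l) =
  [] ∷ cartesianProductWith _∷_ signs (pathsUpTo l)

tuples : ∀ {A : Set} m → List A → List (Vec A m)
tuples zero    xs = [] ∷ []
tuples (suc m) xs = cartesianProductWith _∷_ xs (tuples m xs)

-- In an admissible tuple no path is longer than 2n, so nothing is missed;
-- see ∈-admissibleTuples and admissibleTuples-unique below.
admissibleTuples : (n : ℤ) (m k : ℕ) → List (Vec Path m)
admissibleTuples n m k =
  filter (admissible? n m k) (tuples m (pathsUpTo ∣ + 2 ℤ.* n ∣))

G : (n : ℤ) (m k : ℕ) → ℕ
G n m k = length (admissibleTuples n m k)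

∈-pathsUpTo : ∀ {l} π → length π ≤ l → π ∈ pathsUpTo l
∈-pathsUpTo {zero}  []           _         = here refl
∈-pathsUpTo {suc l} []           _         = here refl
∈-pathsUpTo {suc l} (Sign.+ ∷ π) (s≤s π≤l) =
  there (∈-cartesianProductWith⁺ _∷_ {xs = signs} (here refl) (∈-pathsUpTo π π≤l))
∈-pathsUpTo {suc l} (Sign.- ∷ π) (s≤s π≤l) =
  there (∈-cartesianProductWith⁺ _∷_ {xs = signs} (there (here refl)) (∈-pathsUpTo π π≤l))

pathsUpTo-unique : ∀ l → Unique (pathsUpTo l)
pathsUpTo-unique zero    = All.[] ∷ []
pathsUpTo-unique (suc l) =
  All.tabulate (λ { p refl → []∉ p }) ∷
  Unique.cartesianProductWith⁺ _∷_ List.∷-injective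
    (((λ ()) All.∷ All.[]) ∷ All.[] ∷ []) (pathsUpTo-unique l)
  where
  []∉ : [] ∉ cartesianProductWith _∷_ signs (pathsUpTo l)
  []∉ p with ∈-cartesianProductWith⁻ _∷_ signs (pathsUpTo l) p
  ... | _ , _ , _ , _ , ()

∈-tuples : ∀ {m l} (πs : Vec Path m) → Vec.sum (Vec.map length πs) ≤ l →
           πs ∈ tuples m (pathsUpTo l)
∈-tuples []       _ = here refl
∈-tuples (π ∷ πs) p = ∈-cartesianProductWith⁺ _∷_
  (∈-pathsUpTo π (ℕ.m+n≤o⇒m≤o (length π) p))
  (∈-tuples πs (ℕ.m+n≤o⇒n≤o (length π) p))

tuples-unique : ∀ {A : Set} m {xs : List A} → Unique xs → Unique (tuples m xs)
tuples-unique zero    _ = All.[] ∷ []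
tuples-unique (suc m) u =
  Unique.cartesianProductWith⁺ _∷_ Vec.∷-injective u (tuples-unique m u)

∈-admissibleTuples : ∀ n m k πs → πs ∈ admissibleTuples n m k ⇔ Admissible n m k πs
∈-admissibleTuples n m k πs = mk⇔
  (λ p → proj₂ (∈-filter⁻ (admissible? n m k) {xs = tuples m (pathsUpTo ∣ + 2 ℤ.* n ∣)} p))
  (λ { a@(_ , eq , _) →
       ∈-filter⁺ (admissible? n m k) (∈-tuples πs (ℕ.≤-reflexive (cong ∣_∣ eq))) a })

admissibleTuples-unique : ∀ n m k → Unique (admissibleTuples n m k)
admissibleTuples-unique n m k =
  Unique.filter⁺ (admissible? n m k) (tuples-unique m (pathsUpTo-unique ∣ + 2 ℤ.* n ∣))

{-# OPTIONS --safe #-}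
-- Let z mark length, X = z², and let bₕ be the generating function of the Dyck
-- paths of height less than h, so that b₀ = 0 and bₕ₊₁ = 1 + X bₕ bₕ₊₁.  A tuple
-- whose heights differ by at most k is counted at its least height h, by
--   (bₕ₊₁₊ₖ − bₕ)^m − (bₕ₊₁₊ₖ − bₕ₊₁)^m.
-- For a = bₕ₊₁ the recursion makes bₕ and bₕ₊₂ rational functions of a, and
-- splitting the combination of these terms in the theorem into partial fractions
-- shows that its sum over h telescopes.  As bₕ tends to the Catalan series C, the sum is
-- a polynomial in C, X and X⁻¹, which C = 1 + X C² reduces to the combination
-- 64 Cₙ − 48 Cₙ₊₁ + 12 Cₙ₊₂ − Cₙ₊₃ of Catalan numbers, and this is T(4,n).
module Submission where

open import Defs
open import Data.Nat.Base using (ℕ; _≤_; _+_; _*_)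
open import Data.Integer.Base as ℤ using (+_)
open import Data.Rational.Base as ℚ using (ℚ)
open import Relation.Binary.PropositionalEquality using (_≡_)

open import Algebra.Bundles using (CommutativeRing)
import Algebra.Properties.Semiring.Exp as Exp
import Algebra.Solver.Ring as RingSolver
open import Algebra.Solver.Ring.AlmostCommutativeRing
  using (fromCommutativeRing; _-Raw-AlmostCommutative⟶_)
open import Algebra.Structures using (IsCommutativeRing)
open import Data.Empty using (⊥)
open import Data.Integer.Base using (ℤ; -[1+_]; 0ℤ; 1ℤ; ∣_∣)
import Data.Integer.Properties as ℤ
open import Data.Integer.Tactic.RingSolver using (solve-∀)
open import Data.List.Base as List
  using (List; []; _∷_; _++_; filter; length; inits; cartesianProductWith)
open import Data.List.Relation.Unary.All as All using (All; []; _∷_)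
import Data.List.Relation.Unary.All.Properties as All
open import Data.Maybe.Base as Maybe using (Maybe)
open import Data.Nat.Base as ℕ using (zero; suc; z≤n; s≤s; _!; NonZero)
import Data.Nat.Properties as ℕ
import Data.Nat.Tactic.RingSolver as ℕSolver
open import Data.Product.Base using (_×_; _,_; proj₁; proj₂)
open import Data.Rational.Base using (½)
import Data.Rational.Properties as ℚ
import Data.Rational.Unnormalised.Base as ℚᵘ
import Data.Rational.Unnormalised.Properties as ℚᵘ
open import Data.Sign.Base as Sign using (Sign)
open import Data.Sum.Base using (inj₁; inj₂)
open import Data.Vec.Base as Vec using (Vec; []; _∷_; lookup)
open import Data.Vec.Relation.Unary.All as VecAll using ([]; _∷_)
open import Data.Vec.Relation.Unary.All.Properties using (lookup⁺; lookup⁻)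
import Data.Vec.Relation.Unary.Any as VecAny
open import Function.Base using (_∘_)
open import Function.Bundles using (_⇔_; mk⇔; Equivalence)
open import Level using (0ℓ)
open import Relation.Binary.PropositionalEquality
  using (refl; sym; trans; cong; cong₂; subst; subst₂; module ≡-Reasoning)
import Relation.Binary.Reasoning.Setoid as SetoidReasoning
open import Relation.Nullary using (Dec; yes; no; ¬_; contradiction)
open import Relation.Nullary.Decidable using (_×-dec_; dec⇒maybe)
open import Relation.Unary using (Decidable)

open ≡-Reasoning using (step-≡-⟩; step-≡-⟨)
  renaming (begin_ to begin-≡_; _∎ to _∎-≡)

-- Formal power series

-- With b, a, c for bₕ, bₕ₊₁, bₕ₊₂ the recursion gives b = (a - 1)/(X a) and c = 1/(1 - X a). The
-- only poles in a are therefore 0, 1/X and infinity, so a polynomial in b, a and c splits into a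
-- polynomial in b, one in a and one in c. The sum telescopes when these three polynomials add up to
-- zero as polynomials in one variable. The weights 10 and 4 achieve this; comparing the
-- coefficients of the fourth powers of a and b already forces their ratio 5 : 2. As X has no
-- inverse among integer power series, the expansion is multiplied by X² and proved as a polynomial
-- identity modulo the two recursions. The coefficient of interest then sits four places higher, at
-- 2n + 4. No limit of series is formed either: coefficient N of bₕ is the same for all h > N, and a
-- tuple of total length 2n has no height above 2n, so a finite sum over h gives the exact
-- coefficient. The variable is z and not X because the paths are taken apart one step at a time,
-- which leaves walks of odd length.

Series : Set
Series = ℕ → ℤ

infix 4 _≈_
record _≈_ (f g : Series) : Set where
  constructor pointwise
  field coeff : ∀ n → f n ≡ g n
open _≈_ public

conv : Series → Series → Series
conv f g zero    = f 0 ℤ.* g 0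
conv f g (suc n) = f 0 ℤ.* g (suc n) ℤ.+ conv (f ∘ suc) g n

conv-cong : ∀ {f f′ g g′} → (∀ n → f n ≡ f′ n) → (∀ n → g n ≡ g′ n) →
            ∀ n → conv f g n ≡ conv f′ g′ n
conv-cong p q zero    = cong₂ ℤ._*_ (p 0) (q 0)
conv-cong p q (suc n) =
  cong₂ ℤ._+_ (cong₂ ℤ._*_ (p 0) (q (suc n))) (conv-cong (p ∘ suc) q n)

conv-zeroˡ : ∀ g n → conv (λ _ → 0ℤ) g n ≡ 0ℤ
conv-zeroˡ g zero    = refl
conv-zeroˡ g (suc n) = trans (ℤ.+-identityˡ _) (conv-zeroˡ g n)

conv-distribʳ : ∀ f g h n → conv (λ k → f k ℤ.+ g k) h n ≡ conv f h n ℤ.+ conv g h n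
conv-distribʳ f g h zero    = ℤ.*-distribʳ-+ (h 0) (f 0) (g 0)
conv-distribʳ f g h (suc n) = trans
  (cong (ℤ._+_ ((f 0 ℤ.+ g 0) ℤ.* h (suc n))) (conv-distribʳ (f ∘ suc) (g ∘ suc) h n))
  (lemma (f 0) (g 0) (h (suc n)) _ _)
  where
  lemma : ∀ a b c d e → (a ℤ.+ b) ℤ.* c ℤ.+ (d ℤ.+ e) ≡ (a ℤ.* c ℤ.+ d) ℤ.+ (b ℤ.* c ℤ.+ e)
  lemma = solve-∀

conv-scale : ∀ c f g n → conv (λ k → c ℤ.* f k) g n ≡ c ℤ.* conv f g n
conv-scale c f g zero    = ℤ.*-assoc c (f 0) (g 0)
conv-scale c f g (suc n) = trans
  (cong (ℤ._+_ (c ℤ.* f 0 ℤ.* g (suc n))) (conv-scale c (f ∘ suc) g n))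
  (lemma c (f 0) (g (suc n)) _)
  where
  lemma : ∀ a b c d → a ℤ.* b ℤ.* c ℤ.+ a ℤ.* d ≡ a ℤ.* (b ℤ.* c ℤ.+ d)
  lemma = solve-∀

-- The mirror image of the defining recursion, peeling off the constant coefficient of the second
-- factor. Commutativity is then an induction that plays the two recursions against each other.
conv-sucʳ : ∀ f g n → conv f g (suc n) ≡ f (suc n) ℤ.* g 0 ℤ.+ conv f (g ∘ suc) n
conv-sucʳ f g zero    = ℤ.+-comm (f 0 ℤ.* g 1) (f 1 ℤ.* g 0)
conv-sucʳ f g (suc n) = trans
  (cong (ℤ._+_ (f 0 ℤ.* g (2 ℕ.+ n))) (conv-sucʳ (f ∘ suc) g n))
  (lemma (f 0 ℤ.* g (2 ℕ.+ n)) (f (2 ℕ.+ n) ℤ.* g 0) _)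
  where
  lemma : ∀ a b c → a ℤ.+ (b ℤ.+ c) ≡ b ℤ.+ (a ℤ.+ c)
  lemma = solve-∀

conv-comm : ∀ f g n → conv f g n ≡ conv g f n
conv-comm f g zero    = ℤ.*-comm (f 0) (g 0)
conv-comm f g (suc n) = trans
  (cong₂ ℤ._+_ (ℤ.*-comm (f 0) (g (suc n))) (conv-comm (f ∘ suc) g n))
  (sym (conv-sucʳ g f n))

conv-assoc : ∀ f g h n → conv (conv f g) h n ≡ conv f (conv g h) n
conv-assoc f g h zero    = ℤ.*-assoc (f 0) (g 0) (h 0)
conv-assoc f g h (suc n) = begin-≡
  f 0 ℤ.* g 0 ℤ.* h (suc n) ℤ.+ conv (conv f g ∘ suc) h n
    ≡⟨ cong (ℤ._+_ (f 0 ℤ.* g 0 ℤ.* h (suc n)))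
         (trans (conv-distribʳ (λ k → f 0 ℤ.* g (suc k)) (conv (f ∘ suc) g) h n)
           (cong₂ ℤ._+_ (conv-scale (f 0) (g ∘ suc) h n) (conv-assoc (f ∘ suc) g h n))) ⟩
  f 0 ℤ.* g 0 ℤ.* h (suc n) ℤ.+ (f 0 ℤ.* conv (g ∘ suc) h n ℤ.+ conv (f ∘ suc) (conv g h) n)
    ≡⟨ lemma (f 0) (g 0) (h (suc n)) _ _ ⟩
  f 0 ℤ.* conv g h (suc n) ℤ.+ conv (f ∘ suc) (conv g h) n ∎-≡
  where
  lemma : ∀ a b c d e → a ℤ.* b ℤ.* c ℤ.+ (a ℤ.* d ℤ.+ e) ≡ a ℤ.* (b ℤ.* c ℤ.+ d) ℤ.+ e
  lemma = solve-∀

const : ℤ → Series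
const c zero    = c
const c (suc _) = 0ℤ

conv-const : ∀ c g n → conv (const c) g n ≡ c ℤ.* g n
conv-const c g zero    = refl
conv-const c g (suc n) =
  trans (cong (ℤ._+_ (c ℤ.* g (suc n))) (conv-zeroˡ g n)) (ℤ.+-identityʳ _)

infixl 6 _⊕_
infixl 7 _⊛_
infix  8 ⊖_

opaque
  -- Opaque, so that products are not unfolded into coefficient sums while the solver works with
  -- series as ring elements.
  _⊕_ _⊛_ : Series → Series → Series
  (f ⊕ g) n = f n ℤ.+ g n
  _⊛_ = conv

  ⊖_ : Series → Series
  (⊖ f) n = ℤ.- f n

  ⊕-coeff : ∀ f g n → (f ⊕ g) n ≡ f n ℤ.+ g n
  ⊕-coeff _ _ _ = refl

  ⊖-coeff : ∀ f n → (⊖ f) n ≡ ℤ.- f n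
  ⊖-coeff _ _ = refl

  isCommutativeRing : IsCommutativeRing _≈_ _⊕_ _⊛_ ⊖_ (const 0ℤ) (const 1ℤ)
  isCommutativeRing = record
    { isRing = record
      { +-isAbelianGroup = record
        { isGroup = record
          { isMonoid = record
            { isSemigroup = record
              { isMagma = record
                { isEquivalence = record
                  { refl  = pointwise λ _ → refl
                  ; sym   = λ p → pointwise (sym ∘ coeff p)
                  ; trans = λ p q → pointwise λ n → trans (coeff p n) (coeff q n)
                  }
                ; ∙-cong = λ p q → pointwise λ n → cong₂ ℤ._+_ (coeff p n) (coeff q n)
                }
              ; assoc = λ f g h → pointwise λ n → ℤ.+-assoc (f n) (g n) (h n)
              }
            ; identity = (λ f → pointwise λ n → trans (cong (λ k → k ℤ.+ f n) (const0 n)) (ℤ.+-identityˡ (f n)))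
                       , (λ f → pointwise λ n → trans (cong (ℤ._+_ (f n)) (const0 n)) (ℤ.+-identityʳ (f n)))
            }
          ; inverse = (λ f → pointwise λ n → trans (ℤ.+-inverseˡ (f n)) (sym (const0 n)))
                    , (λ f → pointwise λ n → trans (ℤ.+-inverseʳ (f n)) (sym (const0 n)))
          ; ⁻¹-cong = λ p → pointwise (cong ℤ.-_ ∘ coeff p)
          }
        ; comm = λ f g → pointwise λ n → ℤ.+-comm (f n) (g n)
        }
      ; *-cong = λ p q → pointwise (conv-cong (coeff p) (coeff q))
      ; *-assoc = λ f g h → pointwise (conv-assoc f g h)
      ; *-identity = (λ f → pointwise (1-identity f))
                   , (λ f → pointwise λ n → trans (conv-comm f (const 1ℤ) n) (1-identity f n))
      ; distrib = (λ f g h → pointwise λ n →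
                     trans (conv-comm f (λ k → g k ℤ.+ h k) n)
                       (trans (conv-distribʳ g h f n)
                         (cong₂ ℤ._+_ (conv-comm g f n) (conv-comm h f n))))
                , (λ f g h → pointwise (conv-distribʳ g h f))
      }
    ; *-comm = λ f g → pointwise (conv-comm f g)
    }
    where
    const0 : ∀ n → const 0ℤ n ≡ 0ℤ
    const0 zero    = refl
    const0 (suc _) = refl
    1-identity : ∀ f n → conv (const 1ℤ) f n ≡ f n
    1-identity f n = trans (conv-const 1ℤ f n) (ℤ.*-identityˡ (f n))

seriesRing : CommutativeRing 0ℓ 0ℓ
seriesRing = record { isCommutativeRing = isCommutativeRing }

module 𝕊 = CommutativeRing seriesRing
open 𝕊 using (_-_)
open Exp 𝕊.semiring using (_^_; ^-homo-*)
open SetoidReasoning 𝕊.setoid using (begin_; _∎; step-≈-⟩; step-≈-⟨)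

opaque
  unfolding _⊕_

  const-⊕ : ∀ c d → const (c ℤ.+ d) ≈ const c ⊕ const d
  const-⊕ c d = pointwise λ { zero → refl ; (suc n) → refl }

  const-⊛ : ∀ c d → const (c ℤ.* d) ≈ const c ⊛ const d
  const-⊛ c d = pointwise λ
    { zero    → refl
    ; (suc n) → sym (trans (conv-const c (const d) (suc n)) (ℤ.*-zeroʳ c)) }

  const-⊖ : ∀ c → const (ℤ.- c) ≈ ⊖ const c
  const-⊖ c = pointwise λ { zero → refl ; (suc n) → refl }

const-homo : ℤ.+-*-rawRing -Raw-AlmostCommutative⟶ fromCommutativeRing seriesRing
const-homo = record
  { ⟦_⟧    = const
  ; +-homo = const-⊕
  ; *-homo = const-⊛
  ; -‿homo = const-⊖
  ; 0-homo = 𝕊.refl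
  ; 1-homo = 𝕊.refl
  }

const-≟ : ∀ c d → Maybe (const c ≈ const d)
const-≟ c d = Maybe.map (λ { refl → 𝕊.refl }) (dec⇒maybe (c ℤ.≟ d))

open RingSolver ℤ.+-*-rawRing (fromCommutativeRing seriesRing) const-homo const-≟
  using (Polynomial; solve; _:=_; _:+_; _:*_; _:-_; :-_; _:^_; con)

-- The variable z, truncation and the derivation θ

z X : Series
z 1 = 1ℤ
z _ = 0ℤ
X = z ⊛ z

opaque
  unfolding _⊕_

  minus-coeff : ∀ f g n → (f - g) n ≡ f n ℤ.- g n
  minus-coeff _ _ _ = refl

  const-⊛-coeff : ∀ c f n → (const c ⊛ f) n ≡ c ℤ.* f n
  const-⊛-coeff = conv-const

  z-⊛-coeff-0 : ∀ f → (z ⊛ f) 0 ≡ 0ℤ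
  z-⊛-coeff-0 f = refl

  z-⊛-coeff-suc : ∀ f n → (z ⊛ f) (suc n) ≡ f n
  z-⊛-coeff-suc f n = trans (ℤ.+-identityˡ _) (trans
    (conv-cong {g = f} (λ { zero → refl ; (suc _) → refl }) (λ _ → refl) n)
    (trans (conv-const 1ℤ f n) (ℤ.*-identityˡ (f n))))

X-⊛-coeff : ∀ f n → (X ⊛ f) (2 ℕ.+ n) ≡ f n
X-⊛-coeff f n = trans (coeff (𝕊.*-assoc z z f) (2 ℕ.+ n))
  (trans (z-⊛-coeff-suc (z ⊛ f) (suc n)) (z-⊛-coeff-suc f n))

X-⊛-coeff-0 : ∀ f → (X ⊛ f) 0 ≡ 0ℤ
X-⊛-coeff-0 f = trans (coeff (𝕊.*-assoc z z f) 0) (z-⊛-coeff-0 (z ⊛ f))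

-- Congruence modulo z^(N+1).
infix 4 _≈[_]_
record _≈[_]_ (f : Series) (N : ℕ) (g : Series) : Set where
  constructor pointwise≤
  field coeff≤ : ∀ n → n ℕ.≤ N → f n ≡ g n
open _≈[_]_ public

≈⇒≈[] : ∀ {f g N} → f ≈ g → f ≈[ N ] g
≈⇒≈[] p = pointwise≤ λ n _ → coeff p n

≈[]-refl : ∀ {f N} → f ≈[ N ] f
≈[]-refl = ≈⇒≈[] 𝕊.refl

≈[]-sym : ∀ {f g N} → f ≈[ N ] g → g ≈[ N ] f
≈[]-sym p = pointwise≤ λ n n≤N → sym (coeff≤ p n n≤N)

≈[]-trans : ∀ {f g h N} → f ≈[ N ] g → g ≈[ N ] h → f ≈[ N ] h
≈[]-trans p q = pointwise≤ λ n n≤N → trans (coeff≤ p n n≤N) (coeff≤ q n n≤N)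

opaque
  unfolding _⊕_

  ⊕-cong≤ : ∀ {f f′ g g′ N} → f ≈[ N ] f′ → g ≈[ N ] g′ → f ⊕ g ≈[ N ] f′ ⊕ g′
  ⊕-cong≤ p q = pointwise≤ λ n n≤N → cong₂ ℤ._+_ (coeff≤ p n n≤N) (coeff≤ q n n≤N)

  ⊖-cong≤ : ∀ {f f′ N} → f ≈[ N ] f′ → ⊖ f ≈[ N ] ⊖ f′
  ⊖-cong≤ p = pointwise≤ λ n n≤N → cong ℤ.-_ (coeff≤ p n n≤N)

  -- Coefficient `n` of a product involves only coefficients of index at most `n` of its factors.
  ⊛-cong≤ : ∀ {f f′ g g′ N} → f ≈[ N ] f′ → g ≈[ N ] g′ → f ⊛ g ≈[ N ] f′ ⊛ g′
  ⊛-cong≤ p q = pointwise≤ λ n n≤N → go n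
    (λ k k≤n → coeff≤ p k (ℕ.≤-trans k≤n n≤N)) (λ k k≤n → coeff≤ q k (ℕ.≤-trans k≤n n≤N))
    where
    go : ∀ {f f′ g g′} n → (∀ k → k ℕ.≤ n → f k ≡ f′ k) → (∀ k → k ℕ.≤ n → g k ≡ g′ k) →
         conv f g n ≡ conv f′ g′ n
    go zero    p q = cong₂ ℤ._*_ (p 0 z≤n) (q 0 z≤n)
    go (suc n) p q = cong₂ ℤ._+_ (cong₂ ℤ._*_ (p 0 z≤n) (q (suc n) ℕ.≤-refl))
      (go n (λ k k≤n → p (suc k) (s≤s k≤n)) (λ k k≤n → q k (ℕ.m≤n⇒m≤1+n k≤n)))

^-cong≤ : ∀ {f f′ N} m → f ≈[ N ] f′ → f ^ m ≈[ N ] f′ ^ m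
^-cong≤ zero    p = ≈[]-refl
^-cong≤ (suc m) p = ⊛-cong≤ p (^-cong≤ m p)

-- θ = z d/dz
θ : Series → Series
θ f n = + n ℤ.* f n

θ-cong : ∀ {f g} → f ≈ g → θ f ≈ θ g
θ-cong p = pointwise λ n → cong (ℤ._*_ (+ n)) (coeff p n)

opaque
  unfolding _⊕_

  θ-⊕ : ∀ f g → θ (f ⊕ g) ≈ θ f ⊕ θ g
  θ-⊕ f g = pointwise λ n → ℤ.*-distribˡ-+ (+ n) (f n) (g n)

  θ-⊛ : ∀ f g → θ (f ⊛ g) ≈ θ f ⊛ g ⊕ f ⊛ θ g
  θ-⊛ f g = pointwise (go f g)
    where
    lemma₀ : ∀ a b → 0ℤ ℤ.* (a ℤ.* b) ≡ (0ℤ ℤ.* a) ℤ.* b ℤ.+ a ℤ.* (0ℤ ℤ.* b)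
    lemma₀ = solve-∀
    lemma : ∀ n a b c d e → d ℤ.+ e ≡ n ℤ.* c →
      (1ℤ ℤ.+ n) ℤ.* (a ℤ.* b ℤ.+ c) ≡
      (0ℤ ℤ.* a) ℤ.* b ℤ.+ (c ℤ.+ d) ℤ.+ (a ℤ.* ((1ℤ ℤ.+ n) ℤ.* b) ℤ.+ e)
    lemma n a b c d e eq = trans (lemma₁ n a b c)
      (trans (cong (λ k → (1ℤ ℤ.+ n) ℤ.* (a ℤ.* b) ℤ.+ (c ℤ.+ k)) (sym eq)) (lemma₂ n a b c d e))
      where
      lemma₁ : ∀ n a b c → (1ℤ ℤ.+ n) ℤ.* (a ℤ.* b ℤ.+ c) ≡ (1ℤ ℤ.+ n) ℤ.* (a ℤ.* b) ℤ.+ (c ℤ.+ n ℤ.* c)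
      lemma₁ = solve-∀
      lemma₂ : ∀ n a b c d e → (1ℤ ℤ.+ n) ℤ.* (a ℤ.* b) ℤ.+ (c ℤ.+ (d ℤ.+ e)) ≡
        (0ℤ ℤ.* a) ℤ.* b ℤ.+ (c ℤ.+ d) ℤ.+ (a ℤ.* ((1ℤ ℤ.+ n) ℤ.* b) ℤ.+ e)
      lemma₂ = solve-∀
    -- Shifting commutes with θ only up to one extra copy of the shifted series. This copy supplies
    -- the 1 in the factor `1ℤ ℤ.+ n` of `lemma`.
    θ-suc : ∀ f n → θ f (suc n) ≡ f (suc n) ℤ.+ θ (f ∘ suc) n
    θ-suc f n = trans (ℤ.*-distribʳ-+ (f (suc n)) 1ℤ (+ n))
      (cong (λ k → k ℤ.+ θ (f ∘ suc) n) (ℤ.*-identityˡ (f (suc n))))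
    go : ∀ f g n → θ (conv f g) n ≡ conv (θ f) g n ℤ.+ conv f (θ g) n
    go f g zero    = lemma₀ (f 0) (g 0)
    go f g (suc n) = trans
      (lemma (+ n) (f 0) (g (suc n)) (conv (f ∘ suc) g n) _ _ (sym (go (f ∘ suc) g n)))
      (cong (λ k → (0ℤ ℤ.* f 0) ℤ.* g (suc n) ℤ.+ k
                     ℤ.+ (f 0 ℤ.* θ g (suc n) ℤ.+ conv (f ∘ suc) (θ g) n))
        (sym (trans (conv-cong {g = g} (θ-suc f) (λ _ → refl) n)
          (conv-distribʳ (f ∘ suc) (θ (f ∘ suc)) g n))))

θ-const : ∀ c → θ (const c) ≈ const 0ℤ
θ-const c = pointwise λ { zero → refl ; (suc n) → ℤ.*-zeroʳ (+ suc n) }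

θ-z : θ z ≈ z
θ-z = pointwise λ { 0 → refl ; 1 → refl ; (suc (suc n)) → ℤ.*-zeroʳ (+ (2 ℕ.+ n)) }

θ-X : θ X ≈ const (+ 2) ⊛ X
θ-X = begin
  θ (z ⊛ z)           ≈⟨ θ-⊛ z z ⟩
  θ z ⊛ z ⊕ z ⊛ θ z   ≈⟨ 𝕊.+-cong (𝕊.*-congʳ θ-z) (𝕊.*-congˡ θ-z) ⟩
  z ⊛ z ⊕ z ⊛ z       ≈⟨ solve 1 (λ y → y :* y :+ y :* y := con (+ 2) :* (y :* y)) 𝕊.refl z ⟩
  const (+ 2) ⊛ X ∎

-- The telescoping identity

-- Proves identities modulo an ideal: the solver supplies the cofactor l.
drop-multiple : ∀ {u v} w l → u ≈ v → w ⊕ l ⊛ (u - v) ≈ w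
drop-multiple {u} {v} w l u≈v = begin
  w ⊕ l ⊛ (u - v)  ≈⟨ 𝕊.+-congˡ (𝕊.*-congˡ (𝕊.+-congʳ u≈v)) ⟩
  w ⊕ l ⊛ (v - v)  ≈⟨ solve 3 (λ w l v → w :+ l :* (v :- v) := w) 𝕊.refl w l v ⟩
  w ∎

-- At consecutive terms b, a, c of the sequence bₕ; the vanishing differences
-- a − a are the windows for k = 0.
summand : Series → Series → Series → Series
summand b a c = ((c - b) ^ 4 - (c - a) ^ 4)
  ⊕ const (+ 10) ⊛ (X ⊛ ((a - b) ^ 4 - (a - a) ^ 4))
  ⊕ const (+ 4) ⊛ (X ⊛ (X ⊛ ((a - b) ^ 5 - (a - a) ^ 5)))

-- The partial fraction expansion of X² times the summand is
-- P c + (W − P) a − W b.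
P W : Series → Series
P t = const (+ 4) ⊛ X ^ 2 ⊛ t ^ 3
    ⊕ (const (+ 10) ⊛ X ^ 2 - const (+ 16) ⊛ X) ⊛ t ^ 2
    ⊕ (const (+ 20) ⊛ X ^ 2 - const (+ 24) ⊛ X ⊕ const (+ 24)) ⊛ t
W t = const (+ 4) ⊛ X ^ 4 ⊛ t ^ 5
    - (const (+ 10) ⊛ X ^ 3 ⊕ X ^ 2) ⊛ t ^ 4
    ⊕ (const (+ 20) ⊛ X ^ 3 ⊕ const (+ 4) ⊛ X ^ 2) ⊛ t ^ 3
    - const (+ 30) ⊛ X ^ 2 ⊛ t ^ 2
    ⊕ (const (+ 60) ⊛ X ^ 2 - const (+ 24) ⊛ X) ⊛ t

-- Regrouping P c + (W - P) a - W b as (P c + W a) - (P a + W b) turns the expansion into a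
-- difference at successive pairs of the sequence.
potential : Series → Series → Series
potential b a = P a ⊕ W b

P′ W′ : ∀ {n} (x t : Polynomial n) → Polynomial n
P′ x t = con (+ 4) :* x :^ 2 :* t :^ 3
  :+ (con (+ 10) :* x :^ 2 :- con (+ 16) :* x) :* t :^ 2
  :+ (con (+ 20) :* x :^ 2 :- con (+ 24) :* x :+ con (+ 24)) :* t
W′ x t = con (+ 4) :* x :^ 4 :* t :^ 5
  :- (con (+ 10) :* x :^ 3 :+ x :^ 2) :* t :^ 4
  :+ (con (+ 20) :* x :^ 3 :+ con (+ 4) :* x :^ 2) :* t :^ 3
  :- con (+ 30) :* x :^ 2 :* t :^ 2
  :+ (con (+ 60) :* x :^ 2 :- con (+ 24) :* x) :* t

summand-telescopes : ∀ b a c → a ≈ const 1ℤ ⊕ X ⊛ b ⊛ a → c ≈ const 1ℤ ⊕ X ⊛ a ⊛ c →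
  X ⊛ (X ⊛ summand b a c) ≈ potential a c - potential b a
summand-telescopes b a c a-eq c-eq = begin
  X ⊛ (X ⊛ summand b a c)
    ≈⟨ solve 4 (λ x b a c →
         -- Here `k` is the cofactor of c (1 - a) = b (1 - c), which arises when c times the
         -- relation for a is subtracted from b times the relation for c and the terms X a b c
         -- cancel. It removes the mixed products of b and c; `l` and `m` then account for the
         -- remaining uses of the two relations.
         let one = con 1ℤ
             k   = x :^ 2 :* (con (+ 20) :* (a :- one) :+ con (+ 10) :* (b :- c)
                     :+ con (+ 6) :* c :* (a :+ b) :- con (+ 4) :* (a :^ 2 :+ a :* b :+ b :^ 2 :+ c :^ 2))
             l   = con (+ 24) :- con (+ 40) :* x :- con (+ 16) :* x :* a :+ con (+ 40) :* x :^ 2 :* a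
                     :+ con (+ 24) :* x :* b :- con (+ 40) :* x :^ 2 :* b :- con (+ 20) :* x :^ 2 :* b :* (a :- b)
                     :+ con (+ 20) :* x :^ 3 :* (a :^ 3 :- con (+ 2) :* a :^ 2 :* b :+ con (+ 2) :* a :* b :^ 2 :- b :^ 3)
             m   = con (+ 40) :* x :+ con (+ 16) :* x :* c :- con (+ 24) :* x :* a :- con (+ 24)
         in x :* (x :* summand′ x b a c)
              := P′ x c :+ W′ x a :- (P′ x a :+ W′ x b)
                 :+ (l :- k :* c) :* (a :- (one :+ x :* b :* a))
                 :+ (m :+ k :* b) :* (c :- (one :+ x :* a :* c)))
         𝕊.refl X b a c ⟩
  _ ≈⟨ drop-multiple _ _ c-eq ⟩
  _ ≈⟨ drop-multiple _ _ a-eq ⟩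
  potential a c - potential b a ∎
  where
  summand′ : ∀ {n} (x b a c : Polynomial n) → Polynomial n
  summand′ x b a c = ((c :- b) :^ 4 :- (c :- a) :^ 4)
    :+ con (+ 10) :* (x :* ((a :- b) :^ 4 :- (a :- a) :^ 4))
    :+ con (+ 4) :* (x :* (x :* ((a :- b) :^ 5 :- (a :- a) :^ 5)))

-- The Catalan series

module _ (C : Series) (C-eq : C ≈ const 1ℤ ⊕ X ⊛ C ⊛ C) where

  θ-catalan : θ C ≈ const (+ 2) ⊛ X ⊛ C ⊛ C ⊕ const (+ 2) ⊛ X ⊛ C ⊛ θ C
  θ-catalan = begin
    θ C                                             ≈⟨ θ-cong C-eq ⟩
    θ (const 1ℤ ⊕ X ⊛ C ⊛ C)                        ≈⟨ θ-⊕ _ _ ⟩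
    θ (const 1ℤ) ⊕ θ (X ⊛ C ⊛ C)                    ≈⟨ 𝕊.+-cong (θ-const 1ℤ) (θ-⊛ _ _) ⟩
    const 0ℤ ⊕ (θ (X ⊛ C) ⊛ C ⊕ X ⊛ C ⊛ θ C)
      ≈⟨ 𝕊.+-congˡ (𝕊.+-congʳ (𝕊.*-congʳ (𝕊.trans (θ-⊛ X C) (𝕊.+-congʳ (𝕊.*-congʳ θ-X))))) ⟩
    const 0ℤ ⊕ ((const (+ 2) ⊛ X ⊛ C ⊕ X ⊛ θ C) ⊛ C ⊕ X ⊛ C ⊛ θ C)
      ≈⟨ solve 3 (λ x c t → con 0ℤ :+ ((con (+ 2) :* x :* c :+ x :* t) :* c :+ x :* c :* t)
                   := con (+ 2) :* x :* c :* c :+ con (+ 2) :* x :* c :* t) 𝕊.refl X C (θ C) ⟩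
    const (+ 2) ⊛ X ⊛ C ⊛ C ⊕ const (+ 2) ⊛ X ⊛ C ⊛ θ C ∎

  -- θ C (1 − 2XC) = 2 (C − 1), multiplied by 1 − 2XC, whose square is 1 − 4X.
  catalan-ode : θ C ⊕ const (+ 2) ⊛ C ≈ const (+ 2) ⊕ const (+ 4) ⊛ (X ⊛ (C ⊕ θ C))
  catalan-ode = begin
    θ C ⊕ const (+ 2) ⊛ C
      ≈⟨ solve 3 (λ x c t →
           t :+ con (+ 2) :* c := con (+ 2) :+ con (+ 4) :* (x :* (c :+ t))
             :+ (:- (con (+ 4) :* x :* t :+ con (+ 2) :+ con (+ 4) :* x :* c)) :* (con 1ℤ :+ x :* c :* c :- c)
             :+ (con 1ℤ :- con (+ 2) :* x :* c)
                :* (t :- (con (+ 2) :* x :* c :* c :+ con (+ 2) :* x :* c :* t)))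
           𝕊.refl X C (θ C) ⟩
    _ ≈⟨ drop-multiple _ _ θ-catalan ⟩
    _ ≈⟨ drop-multiple _ _ (𝕊.sym C-eq) ⟩
    const (+ 2) ⊕ const (+ 4) ⊛ (X ⊛ (C ⊕ θ C)) ∎

  -- The left side is (P + W)(C) up to a polynomial in X, reduced by C = 1 + X C². The square is
  -- kept because C² = (C - 1)/X is a mere shift of coefficients, with no division needed. The last
  -- three terms have degree at most 4 in z and do not reach the coefficient that is read off later.
  catalan-limit : potential C C - potential (const 0ℤ) (const 1ℤ) ≈
    ⊖ (C ⊛ C) ⊕ const (+ 12) ⊛ C ⊕ const -[1+ 47 ] ⊛ (X ⊛ C) ⊕ const (+ 64) ⊛ (X ⊛ (X ⊛ C))
    ⊕ const -[1+ 10 ] ⊕ X ⊛ const (+ 38) ⊕ X ⊛ (X ⊛ const -[1+ 33 ])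
  catalan-limit = begin
    potential C C - potential (const 0ℤ) (const 1ℤ)
      ≈⟨ solve 2 (λ x c →
           P′ x c :+ W′ x c :- (P′ x (con 1ℤ) :+ W′ x (con 0ℤ)) :=
           :- (c :* c) :+ con (+ 12) :* c :+ con -[1+ 47 ] :* (x :* c) :+ con (+ 64) :* (x :* (x :* c))
           :+ con -[1+ 10 ] :+ x :* con (+ 38) :+ x :* (x :* con -[1+ 33 ])
           :+ (con (+ 13) :- con (+ 2) :* x :+ (con 1ℤ :- con (+ 2) :* x :- con (+ 16) :* x :^ 2) :* c
               :+ (x :+ con (+ 6) :* x :^ 2) :* c :^ 2 :- con (+ 4) :* x :^ 3 :* c :^ 3)
              :* (c :- (con 1ℤ :+ x :* c :* c)))
           𝕊.refl X C ⟩
    _ ≈⟨ drop-multiple _ _ C-eq ⟩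
    _ ∎

-- Walks in a strip

mutual
  -- r is the room above the current height j: a walk stays between 0 and j + r.
  walks : (j r n : ℕ) → ℕ
  walks j       r (suc n) = walks↑ j r n ℕ.+ walks↓ j r n
  walks zero    r zero    = 1
  walks (suc _) r zero    = 0

  walks↑ walks↓ : (j r n : ℕ) → ℕ
  walks↑ j zero    n = 0
  walks↑ j (suc r) n = walks (suc j) r n
  walks↓ zero    r n = 0
  walks↓ (suc j) r n = walks j (suc r) n

walkSeries walkSeries↑ walkSeries↓ : (j r : ℕ) → Series
walkSeries  j r n = + walks j r n
walkSeries↑ j r n = + walks↑ j r n
walkSeries↓ j r n = + walks↓ j r n

const-0 : (λ _ → 0ℤ) ≈ const 0ℤ
const-0 = pointwise λ { zero → refl ; (suc _) → refl }

δ₀ : ℕ → Series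
δ₀ zero    = const 1ℤ
δ₀ (suc _) = const 0ℤ

walkSeries-step : ∀ j r → walkSeries j r ≈ δ₀ j ⊕ z ⊛ (walkSeries↑ j r ⊕ walkSeries↓ j r)
walkSeries-step j r = pointwise λ n → sym (trans (⊕-coeff _ _ n) (go j n))
  where
  step : ∀ j n → (z ⊛ (walkSeries↑ j r ⊕ walkSeries↓ j r)) (suc n) ≡ + walks j r (suc n)
  step j n = trans (z-⊛-coeff-suc _ n) (⊕-coeff _ _ n)
  go : ∀ j n → δ₀ j n ℤ.+ (z ⊛ (walkSeries↑ j r ⊕ walkSeries↓ j r)) n ≡ + walks j r n
  go zero    zero    = cong (ℤ._+_ 1ℤ) (z-⊛-coeff-0 _)
  go (suc j) zero    = cong (ℤ._+_ 0ℤ) (z-⊛-coeff-0 _)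
  go zero    (suc n) = trans (ℤ.+-identityˡ _) (step zero n)
  go (suc j) (suc n) = trans (ℤ.+-identityˡ _) (step (suc j) n)

-- At its first visit to height 0 a walk from height j + 1 splits into a walk down
-- to height 1 that stays above height 0, one step, and a walk from 0 to 0.
module _ (h : ℕ) where
  private M = walkSeries 0 h

  passage  : ∀ n j r → h ≡ j ℕ.+ suc r → (z ⊛ (walkSeries j r ⊛ M)) n ≡ + walks (suc j) r n
  passage↑ : ∀ n j r → h ≡ j ℕ.+ suc r → (z ⊛ (walkSeries↑ j r ⊛ M)) n ≡ + walks↑ (suc j) r n
  passage↓ : ∀ n j r → h ≡ j ℕ.+ suc r →
    (δ₀ j ⊛ M ⊕ z ⊛ (walkSeries↓ j r ⊛ M)) n ≡ + walks↓ (suc j) r n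

  passage zero    j r _  = z-⊛-coeff-0 _
  passage (suc n) j r eq =
    trans (z-⊛-coeff-suc _ n) (trans (coeff expand n)
      (trans (⊕-coeff _ _ n) (cong₂ ℤ._+_ (passage↑ n j r eq) (passage↓ n j r eq))))
    where
    expand : walkSeries j r ⊛ M ≈
      z ⊛ (walkSeries↑ j r ⊛ M) ⊕ (δ₀ j ⊛ M ⊕ z ⊛ (walkSeries↓ j r ⊛ M))
    expand = begin
      walkSeries j r ⊛ M
        ≈⟨ 𝕊.*-congʳ (walkSeries-step j r) ⟩
      (δ₀ j ⊕ z ⊛ (walkSeries↑ j r ⊕ walkSeries↓ j r)) ⊛ M
        ≈⟨ solve 5 (λ e y u d m → (e :+ y :* (u :+ d)) :* m := y :* (u :* m) :+ (e :* m :+ y :* (d :* m)))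
             𝕊.refl (δ₀ j) z (walkSeries↑ j r) (walkSeries↓ j r) M ⟩
      _ ∎

  passage↑ n j zero    _  = coeff no-walks n
    where
    no-walks : z ⊛ (walkSeries↑ j 0 ⊛ M) ≈ λ _ → 0ℤ
    no-walks = begin
      z ⊛ (walkSeries↑ j 0 ⊛ M) ≈⟨ 𝕊.*-congˡ (𝕊.*-congʳ const-0) ⟩
      z ⊛ (const 0ℤ ⊛ M)        ≈⟨ solve 2 (λ y m → y :* (con 0ℤ :* m) := con 0ℤ) 𝕊.refl z M ⟩
      const 0ℤ                  ≈⟨ const-0 ⟨
      (λ _ → 0ℤ) ∎
  passage↑ n j (suc r) eq = passage n (suc j) r (trans eq (ℕ.+-suc j (suc r)))

  -- The step from height 1 to 0 is the first visit to 0. Whatever follows may use the whole strip,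
  -- and at height 0 the room `suc r` is all of `h`.
  passage↓ n zero    r refl = coeff only-M n
    where
    only-M : const 1ℤ ⊛ M ⊕ z ⊛ (walkSeries↓ 0 r ⊛ M) ≈ M
    only-M = begin
      const 1ℤ ⊛ M ⊕ z ⊛ (walkSeries↓ 0 r ⊛ M)
        ≈⟨ 𝕊.+-congˡ (𝕊.*-congˡ (𝕊.*-congʳ const-0)) ⟩
      const 1ℤ ⊛ M ⊕ z ⊛ (const 0ℤ ⊛ M)
        ≈⟨ solve 2 (λ y m → con 1ℤ :* m :+ y :* (con 0ℤ :* m) := m) 𝕊.refl z M ⟩
      M ∎
  passage↓ n (suc j) r eq = trans
    (coeff (solve 2 (λ m t → con 0ℤ :* m :+ t := t) 𝕊.refl M _) n)
    (passage n j (suc r) (trans eq (sym (ℕ.+-suc j (suc r)))))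

-- By height strictly less than h, so that bounded 0 = 0.
bounded : ℕ → Series
bounded zero    = const 0ℤ
bounded (suc h) = walkSeries 0 h

-- First-return decomposition: after the initial rise, `passage` at `j = 0` cuts the walk at its
-- return to 0. The part in between stays above height 0 and so has one unit of height less at its
-- disposal. The convention `bounded 0 = 0` makes the rule valid for the strip without room.
bounded-rec : ∀ h → bounded (suc h) ≈ const 1ℤ ⊕ X ⊛ bounded h ⊛ bounded (suc h)
bounded-rec zero    = begin
  walkSeries 0 0
    ≈⟨ walkSeries-step 0 0 ⟩
  const 1ℤ ⊕ z ⊛ (walkSeries↑ 0 0 ⊕ walkSeries↓ 0 0)
    ≈⟨ 𝕊.+-congˡ (𝕊.*-congˡ (𝕊.+-cong const-0 const-0)) ⟩
  const 1ℤ ⊕ z ⊛ (const 0ℤ ⊕ const 0ℤ)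
    ≈⟨ solve 2 (λ y b → con 1ℤ :+ y :* (con 0ℤ :+ con 0ℤ) := con 1ℤ :+ y :* y :* con 0ℤ :* b)
         𝕊.refl z (walkSeries 0 0) ⟩
  const 1ℤ ⊕ X ⊛ const 0ℤ ⊛ walkSeries 0 0 ∎
bounded-rec (suc h) = begin
  walkSeries 0 (suc h)
    ≈⟨ walkSeries-step 0 (suc h) ⟩
  const 1ℤ ⊕ z ⊛ (walkSeries 1 h ⊕ walkSeries↓ 0 (suc h))
    ≈⟨ 𝕊.+-congˡ (𝕊.*-congˡ (𝕊.+-cong (𝕊.sym (pointwise λ n → passage (suc h) n 0 h refl)) const-0)) ⟩
  const 1ℤ ⊕ z ⊛ (z ⊛ (walkSeries 0 h ⊛ walkSeries 0 (suc h)) ⊕ const 0ℤ)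
    ≈⟨ solve 3 (λ y a b → con 1ℤ :+ y :* (y :* (a :* b) :+ con 0ℤ) := con 1ℤ :+ y :* y :* a :* b)
         𝕊.refl z (walkSeries 0 h) (walkSeries 0 (suc h)) ⟩
  const 1ℤ ⊕ X ⊛ walkSeries 0 h ⊛ walkSeries 0 (suc h) ∎

-- In `n` steps a walk rises by at most `n`, so any room of that size is as good as infinite. A step
-- up uses one unit of room and one step together; a step down even adds room, hence the weakenings
-- by two.
walks-unbounded : ∀ {j r r′ n} → n ℕ.≤ r → n ℕ.≤ r′ → walks j r n ≡ walks j r′ n
walks-unbounded {zero}  {n = zero} _ _ = refl
walks-unbounded {suc _} {n = zero} _ _ = refl
walks-unbounded {zero}  {n = suc n} (s≤s p) (s≤s q) =
  cong (ℕ._+ 0) (walks-unbounded p q)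
walks-unbounded {suc j} {n = suc n} (s≤s p) (s≤s q) =
  cong₂ ℕ._+_ (walks-unbounded p q)
    (walks-unbounded {j} (ℕ.m≤n⇒m≤1+n (ℕ.m≤n⇒m≤1+n p)) (ℕ.m≤n⇒m≤1+n (ℕ.m≤n⇒m≤1+n q)))

-- The Catalan series C, written in z: room `n` does not restrict a walk of `n` steps, so the
-- diagonal gives the limit of `bounded` directly.
dyck : Series
dyck n = + walks 0 n n

bounded-limit : ∀ {N h} → N ℕ.< h → bounded h ≈[ N ] dyck
bounded-limit (s≤s N≤h) = pointwise≤ λ n n≤N →
  cong +_ (walks-unbounded (ℕ.≤-trans n≤N N≤h) ℕ.≤-refl)

-- Coefficient `n` can be compared in the recursion for bounded paths, once the height bounds exceed
-- `n`.
dyck-eq : dyck ≈ const 1ℤ ⊕ X ⊛ dyck ⊛ dyck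
dyck-eq = pointwise λ n → coeff≤
  (≈[]-trans (≈[]-sym (limit n ℕ.≤-refl))
    (≈[]-trans (≈⇒≈[] (bounded-rec (suc n)))
      (⊕-cong≤ ≈[]-refl
        (⊛-cong≤ (⊛-cong≤ ≈[]-refl (bounded-limit ℕ.≤-refl)) (limit n ℕ.≤-refl)))))
  n ℕ.≤-refl
  where
  limit : ∀ n {N} → N ℕ.≤ n → bounded (2 ℕ.+ n) ≈[ N ] dyck
  limit n N≤n = bounded-limit (s≤s (ℕ.m≤n⇒m≤1+n N≤n))

-- Indicators and sums over lists

⟦_⟧ : ∀ {P : Set} → Dec P → ℤ
⟦ yes _ ⟧ = 1ℤ
⟦ no _ ⟧  = 0ℤ

⟦⟧-cong : ∀ {P Q : Set} → (P → Q) → (Q → P) → (P? : Dec P) (Q? : Dec Q) → ⟦ P? ⟧ ≡ ⟦ Q? ⟧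
⟦⟧-cong f g (yes p) (yes q) = refl
⟦⟧-cong f g (yes p) (no ¬q) = contradiction (f p) ¬q
⟦⟧-cong f g (no ¬p) (yes q) = contradiction (g q) ¬p
⟦⟧-cong f g (no ¬p) (no ¬q) = refl

⟦⟧-no : ∀ {P : Set} (P? : Dec P) → ¬ P → ⟦ P? ⟧ ≡ 0ℤ
⟦⟧-no (yes p) ¬p = contradiction p ¬p
⟦⟧-no (no _)  _  = refl

⟦⟧-× : ∀ {P Q : Set} (P? : Dec P) (Q? : Dec Q) → ⟦ P? ×-dec Q? ⟧ ≡ ⟦ P? ⟧ ℤ.* ⟦ Q? ⟧
⟦⟧-× (yes _) (yes _) = refl
⟦⟧-× (yes _) (no _)  = refl
⟦⟧-× (no _)  Q?      = refl

module _ {A : Set} where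

  count : {P : A → Set} → Decidable P → List A → ℤ
  count P? []       = 0ℤ
  count P? (x ∷ xs) = ⟦ P? x ⟧ ℤ.+ count P? xs

  length-filter : ∀ {P : A → Set} (P? : Decidable P) xs → + length (filter P? xs) ≡ count P? xs
  length-filter P? []       = refl
  length-filter P? (x ∷ xs) with P? x
  ... | yes _ = cong (ℤ._+_ 1ℤ) (length-filter P? xs)
  ... | no _  = trans (length-filter P? xs) (sym (ℤ.+-identityˡ _))

  count-cong : ∀ {P Q : A → Set} (P? : Decidable P) (Q? : Decidable Q) →
               (∀ x → ⟦ P? x ⟧ ≡ ⟦ Q? x ⟧) → ∀ xs → count P? xs ≡ count Q? xs
  count-cong P? Q? eq []       = refl
  count-cong P? Q? eq (x ∷ xs) = cong₂ ℤ._+_ (eq x) (count-cong P? Q? eq xs)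

  count-none : ∀ {P : A → Set} (P? : Decidable P) → (∀ x → ⟦ P? x ⟧ ≡ 0ℤ) → ∀ xs → count P? xs ≡ 0ℤ
  count-none P? eq []       = refl
  count-none P? eq (x ∷ xs) = cong₂ ℤ._+_ (eq x) (count-none P? eq xs)

  count-diff : ∀ {P Q R S : A → Set}
    (P? : Decidable P) (Q? : Decidable Q) (R? : Decidable R) (S? : Decidable S) →
    (∀ x → ⟦ P? x ⟧ ℤ.- ⟦ Q? x ⟧ ≡ ⟦ R? x ⟧ ℤ.- ⟦ S? x ⟧) →
    ∀ xs → count P? xs ℤ.- count Q? xs ≡ count R? xs ℤ.- count S? xs
  count-diff P? Q? R? S? eq []       = refl
  count-diff P? Q? R? S? eq (x ∷ xs) = trans (regroup ⟦ P? x ⟧ (count P? xs) ⟦ Q? x ⟧ (count Q? xs))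
    (trans (cong₂ ℤ._+_ (eq x) (count-diff P? Q? R? S? eq xs))
      (sym (regroup ⟦ R? x ⟧ (count R? xs) ⟦ S? x ⟧ (count S? xs))))
    where
    regroup : ∀ a b c d → (a ℤ.+ b) ℤ.- (c ℤ.+ d) ≡ (a ℤ.- c) ℤ.+ (b ℤ.- d)
    regroup = solve-∀

  sumOver : List A → (A → Series) → Series
  sumOver []       f = const 0ℤ
  sumOver (x ∷ xs) f = f x ⊕ sumOver xs f

  sumOver-coeff : ∀ {P : A → Set} (P? : Decidable P) {f : A → Series} {n} →
    (∀ x → f x n ≡ ⟦ P? x ⟧) → ∀ xs → sumOver xs f n ≡ count P? xs
  sumOver-coeff P? {n = zero}  eq []       = refl
  sumOver-coeff P? {n = suc n} eq []       = refl
  sumOver-coeff P? {n = n}     eq (x ∷ xs) =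
    trans (⊕-coeff _ _ n) (cong₂ ℤ._+_ (eq x) (sumOver-coeff P? eq xs))

  sumOver-cong : ∀ {f g : A → Series} → (∀ x → f x ≈ g x) → ∀ xs → sumOver xs f ≈ sumOver xs g
  sumOver-cong eq []       = 𝕊.refl
  sumOver-cong eq (x ∷ xs) = 𝕊.+-cong (eq x) (sumOver-cong eq xs)

  sumOver-++ : ∀ f xs ys → sumOver (xs ++ ys) f ≈ sumOver xs f ⊕ sumOver ys f
  sumOver-++ f []       ys = 𝕊.sym (𝕊.+-identityˡ _)
  sumOver-++ f (x ∷ xs) ys =
    𝕊.trans (𝕊.+-congˡ (sumOver-++ f xs ys)) (𝕊.sym (𝕊.+-assoc _ _ _))

  sumOver-- : ∀ f g xs → sumOver xs (λ x → f x - g x) ≈ sumOver xs f - sumOver xs g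
  sumOver-- f g []       = solve 0 (con 0ℤ := con 0ℤ :- con 0ℤ) 𝕊.refl
  sumOver-- f g (x ∷ xs) = 𝕊.trans (𝕊.+-congˡ (sumOver-- f g xs))
    (solve 4 (λ a b c d → a :- b :+ (c :- d) := a :+ c :- (b :+ d)) 𝕊.refl _ _ _ _)

  sumOver-⊛ˡ : ∀ f g xs → sumOver xs (λ x → f ⊛ g x) ≈ f ⊛ sumOver xs g
  sumOver-⊛ˡ f g []       = 𝕊.sym (𝕊.zeroʳ f)
  sumOver-⊛ˡ f g (x ∷ xs) = 𝕊.trans (𝕊.+-congˡ (sumOver-⊛ˡ f g xs)) (𝕊.sym (𝕊.distribˡ _ _ _))

  sumOver-⊛ʳ : ∀ f g xs → sumOver xs (λ x → g x ⊛ f) ≈ sumOver xs g ⊛ f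
  sumOver-⊛ʳ f g xs = 𝕊.trans (sumOver-cong (λ x → 𝕊.*-comm (g x) f) xs)
    (𝕊.trans (sumOver-⊛ˡ f g xs) (𝕊.*-comm _ _))

sumOver-map : ∀ {A B : Set} (h : A → B) f xs → sumOver (List.map h xs) f ≈ sumOver xs (f ∘ h)
sumOver-map h f []       = 𝕊.refl
sumOver-map h f (x ∷ xs) = 𝕊.+-congˡ (sumOver-map h f xs)

sumOver-cartesianProductWith : ∀ {A B C : Set} (h : A → B → C) f xs ys →
  sumOver (cartesianProductWith h xs ys) f ≈ sumOver xs (λ x → sumOver ys (f ∘ h x))
sumOver-cartesianProductWith h f []       ys = 𝕊.refl
sumOver-cartesianProductWith h f (x ∷ xs) ys =
  𝕊.trans (sumOver-++ f (List.map (h x) ys) _)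
    (𝕊.+-cong (sumOver-map (h x) f ys) (sumOver-cartesianProductWith h f xs ys))

prodOver : ∀ {A : Set} {m} → (A → Series) → Vec A m → Series
prodOver f []       = const 1ℤ
prodOver f (x ∷ xs) = f x ⊛ prodOver f xs

-- Expanding the power: choosing one term from each factor amounts to choosing a tuple.
sumOver-tuples : ∀ {A : Set} (f : A → Series) m xs →
  sumOver (tuples m xs) (prodOver f) ≈ sumOver xs f ^ m
sumOver-tuples f zero    xs = 𝕊.+-identityʳ _
sumOver-tuples f (suc m) xs = begin
  sumOver (tuples (suc m) xs) (prodOver f)
    ≈⟨ sumOver-cartesianProductWith _∷_ (prodOver f) xs (tuples m xs) ⟩
  sumOver xs (λ x → sumOver (tuples m xs) (λ v → f x ⊛ prodOver f v))
    ≈⟨ sumOver-cong (λ x → sumOver-⊛ˡ (f x) (prodOver f) (tuples m xs)) xs ⟩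
  sumOver xs (λ x → f x ⊛ sumOver (tuples m xs) (prodOver f))
    ≈⟨ sumOver-⊛ʳ _ f xs ⟩
  sumOver xs f ⊛ sumOver (tuples m xs) (prodOver f)
    ≈⟨ 𝕊.*-congˡ (sumOver-tuples f m xs) ⟩
  sumOver xs f ⊛ sumOver xs f ^ m ∎

z^-coeff : ∀ k n → (z ^ k) n ≡ ⟦ k ℕ.≟ n ⟧
z^-coeff zero    zero    = refl
z^-coeff zero    (suc n) = refl
z^-coeff (suc k) zero    = z-⊛-coeff-0 _
z^-coeff (suc k) (suc n) = trans (z-⊛-coeff-suc _ n)
  (trans (z^-coeff k n) (⟦⟧-cong (cong suc) ℕ.suc-injective (k ℕ.≟ n) (suc k ℕ.≟ suc n)))

-- Dyck paths as walks

mutual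
  -- Follows the recursion of `walks` clause by clause, so that counting these paths is an induction
  -- on the first step. The description by partial sums is linked to it separately, in `walk⇒strip`
  -- and `strip⇒walk`.
  Walk : (j r : ℕ) → Path → Set
  Walk j r []           = j ≡ 0
  Walk j r (Sign.+ ∷ π) = Walk↑ j r π
  Walk j r (Sign.- ∷ π) = Walk↓ j r π

  Walk↑ Walk↓ : (j r : ℕ) → Path → Set
  Walk↑ j zero    π = ⊥
  Walk↑ j (suc r) π = Walk (suc j) r π
  Walk↓ zero    r π = ⊥
  Walk↓ (suc j) r π = Walk j (suc r) π

mutual
  walk? : ∀ j r → Decidable (Walk j r)
  walk? j r []           = j ℕ.≟ 0
  walk? j r (Sign.+ ∷ π) = walk↑? j r π
  walk? j r (Sign.- ∷ π) = walk↓? j r π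

  walk↑? : ∀ j r → Decidable (Walk↑ j r)
  walk↑? j zero    π = no λ ()
  walk↑? j (suc r) π = walk? (suc j) r π

  walk↓? : ∀ j r → Decidable (Walk↓ j r)
  walk↓? zero    r π = no λ ()
  walk↓? (suc j) r π = walk? j (suc r) π

weight : {P : Path → Set} → Decidable P → Path → Series
weight P? π = const ⟦ P? π ⟧ ⊛ z ^ length π

-- The factor z gains one degree of precision. This makes up for the step by which the paths become
-- shorter in the induction of `sum-walks`.
z-⊛-cong≤ : ∀ {f g N} → f ≈[ N ] g → z ⊛ f ≈[ suc N ] z ⊛ g
z-⊛-cong≤ {f} {g} p = pointwise≤ λ
  { zero    _         → trans (z-⊛-coeff-0 f) (sym (z-⊛-coeff-0 g))
  ; (suc n) (s≤s n≤N) → trans (z-⊛-coeff-suc f n) (trans (coeff≤ p n n≤N) (sym (z-⊛-coeff-suc g n))) }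

never? : Decidable {A = Path} (λ _ → ⊥)
never? _ = no λ ()

sum-never : ∀ L → sumOver (pathsUpTo L) (weight never?) ≈ (λ _ → 0ℤ)
sum-never L = pointwise λ n → trans
  (sumOver-coeff never?
    (λ π → trans (const-⊛-coeff 0ℤ (z ^ length π) n) (ℤ.*-zeroˡ ((z ^ length π) n))) (pathsUpTo L))
  (count-none never? (λ _ → refl) (pathsUpTo L))

weight-[] : ∀ j r → weight (walk? j r) [] ≈ δ₀ j
weight-[] zero    r = 𝕊.*-identityʳ _
weight-[] (suc j) r = 𝕊.*-identityʳ _

-- Splitting the paths by their first step reproduces `walkSeries-step`. The agreement stops at
-- degree `L` because longer paths are absent from the list.
sum-walks  : ∀ L j r → sumOver (pathsUpTo L) (weight (walk? j r)) ≈[ L ] walkSeries j r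
sum-walks↑ : ∀ L j r → sumOver (pathsUpTo L) (weight (walk↑? j r)) ≈[ L ] walkSeries↑ j r
sum-walks↓ : ∀ L j r → sumOver (pathsUpTo L) (weight (walk↓? j r)) ≈[ L ] walkSeries↓ j r

sum-walks zero j r = pointwise≤ λ { zero z≤n → trans
  (coeff (𝕊.trans (𝕊.+-identityʳ _) (weight-[] j r)) 0) (coeff₀ j) }
  where
  coeff₀ : ∀ j → δ₀ j 0 ≡ walkSeries j r 0
  coeff₀ zero    = refl
  coeff₀ (suc j) = refl
sum-walks (suc L) j r = ≈[]-trans (≈⇒≈[] split)
  (≈[]-trans (⊕-cong≤ ≈[]-refl (z-⊛-cong≤ (⊕-cong≤ (sum-walks↑ L j r) (sum-walks↓ L j r))))
    (≈⇒≈[] (𝕊.sym (walkSeries-step j r))))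
  where
  ps : List Path
  ps = pathsUpTo L
  first-step : ∀ {P : Path → Set} (P? : Decidable P) →
    sumOver ps (λ π → const ⟦ P? π ⟧ ⊛ (z ⊛ z ^ length π)) ≈ z ⊛ sumOver ps (weight P?)
  first-step P? = 𝕊.trans
    (sumOver-cong (λ π → solve 3 (λ c y e → c :* (y :* e) := y :* (c :* e)) 𝕊.refl
                           (const ⟦ P? π ⟧) z (z ^ length π)) ps)
    (sumOver-⊛ˡ z (weight P?) ps)
  split : sumOver (pathsUpTo (suc L)) (weight (walk? j r)) ≈
    δ₀ j ⊕ z ⊛ (sumOver ps (weight (walk↑? j r)) ⊕ sumOver ps (weight (walk↓? j r)))
  split = 𝕊.+-cong (weight-[] j r) (begin
    sumOver (cartesianProductWith _∷_ signs ps) (weight (walk? j r))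
      ≈⟨ sumOver-cartesianProductWith _∷_ (weight (walk? j r)) signs ps ⟩
    _ ≈⟨ 𝕊.+-cong (first-step (walk↑? j r)) (𝕊.+-congʳ (first-step (walk↓? j r))) ⟩
    z ⊛ sumOver ps (weight (walk↑? j r)) ⊕ (z ⊛ sumOver ps (weight (walk↓? j r)) ⊕ const 0ℤ)
      ≈⟨ solve 3 (λ y u d → y :* u :+ (y :* d :+ con 0ℤ) := y :* (u :+ d)) 𝕊.refl z _ _ ⟩
    z ⊛ (sumOver ps (weight (walk↑? j r)) ⊕ sumOver ps (weight (walk↓? j r))) ∎)

sum-walks↑ L j zero    = ≈⇒≈[] (sum-never L)
sum-walks↑ L j (suc r) = sum-walks L (suc j) r
sum-walks↓ L zero    r = ≈⇒≈[] (sum-never L)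
sum-walks↓ L (suc j) r = sum-walks L j (suc r)

-- Partial sums are measured from the starting height `j`. The ceiling `j + r` is what remains fixed
-- when a step moves the start.
Strip : (j r : ℕ) → ℤ → Set
Strip j r s = 0ℤ ℤ.≤ + j ℤ.+ s × + j ℤ.+ s ℤ.≤ + (j ℕ.+ r)

strip-head : ∀ j r → Strip j r 0ℤ
strip-head j r = ℤ.+≤+ z≤n , ℤ.+≤+ (ℕ.+-monoʳ-≤ j z≤n)

up-eq : ∀ j s → + j ℤ.+ (1ℤ ℤ.+ s) ≡ + suc j ℤ.+ s
up-eq j s = trans (lemma (+ j) s) refl
  where
  lemma : ∀ j s → j ℤ.+ (1ℤ ℤ.+ s) ≡ (1ℤ ℤ.+ j) ℤ.+ s
  lemma = solve-∀

down-eq : ∀ j s → + suc j ℤ.+ (-[1+ 0 ] ℤ.+ s) ≡ + j ℤ.+ s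
down-eq j s = lemma (+ j) s
  where
  lemma : ∀ j s → (1ℤ ℤ.+ j) ℤ.+ (-[1+ 0 ] ℤ.+ s) ≡ j ℤ.+ s
  lemma = solve-∀

strip-↑ : ∀ j r s → Strip j (suc r) (1ℤ ℤ.+ s) ⇔ Strip (suc j) r s
strip-↑ j r s = mk⇔
  (λ (p , q) → subst (0ℤ ℤ.≤_) (up-eq j s) p , subst₂ ℤ._≤_ (up-eq j s) (cong +_ (ℕ.+-suc j r)) q)
  (λ (p , q) → subst (0ℤ ℤ.≤_) (sym (up-eq j s)) p ,
               subst₂ ℤ._≤_ (sym (up-eq j s)) (cong +_ (sym (ℕ.+-suc j r))) q)

strip-↓ : ∀ j r s → Strip (suc j) r (-[1+ 0 ] ℤ.+ s) ⇔ Strip j (suc r) s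
strip-↓ j r s = mk⇔
  (λ (p , q) → subst (0ℤ ℤ.≤_) (down-eq j s) p , subst₂ ℤ._≤_ (down-eq j s) (cong +_ (sym (ℕ.+-suc j r))) q)
  (λ (p , q) → subst (0ℤ ℤ.≤_) (sym (down-eq j s)) p ,
               subst₂ ℤ._≤_ (sym (down-eq j s)) (cong +_ (ℕ.+-suc j r)) q)

partialSums-∷⁺ : ∀ {P : ℤ → Set} σ π → P 0ℤ → All (λ s → P ((σ ℤ.◃ 1) ℤ.+ s)) (partialSums π) →
                 All P (partialSums (σ ∷ π))
partialSums-∷⁺ σ π p₀ ps = p₀ ∷
  All.map⁺ {xs = List.map (σ ∷_) (inits π)} {f = total} (All.map⁺ (All.map⁻ {xs = inits π} ps))

partialSums-∷⁻ : ∀ {P : ℤ → Set} σ π → All P (partialSums (σ ∷ π)) →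
                 All (λ s → P ((σ ℤ.◃ 1) ℤ.+ s)) (partialSums π)
partialSums-∷⁻ σ π (_ ∷ ps) =
  All.map⁺ {xs = inits π} (All.map⁻ (All.map⁻ {xs = List.map (σ ∷_) (inits π)} {f = total} ps))

walk⇒strip : ∀ j r π → Walk j r π → + j ℤ.+ total π ≡ 0ℤ × All (Strip j r) (partialSums π)
walk⇒strip j r [] refl = refl , strip-head 0 r ∷ []
walk⇒strip j (suc r) (Sign.+ ∷ π) w with walk⇒strip (suc j) r π w
... | t , ps = trans (up-eq j (total π)) t ,
  partialSums-∷⁺ Sign.+ π (strip-head j (suc r)) (All.map (λ {s} → Equivalence.from (strip-↑ j r s)) ps)
walk⇒strip (suc j) r (Sign.- ∷ π) w with walk⇒strip j (suc r) π w
... | t , ps = trans (down-eq j (total π)) t ,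
  partialSums-∷⁺ Sign.- π (strip-head (suc j) r) (All.map (λ {s} → Equivalence.from (strip-↓ j r s)) ps)

strip⇒walk : ∀ j r π → + j ℤ.+ total π ≡ 0ℤ → All (Strip j r) (partialSums π) → Walk j r π
strip⇒walk j r [] t ps = trans (sym (ℕ.+-identityʳ j)) (ℤ.+-injective t)
-- The partial sum after one step already lies above the ceiling `j`.
strip⇒walk j zero (Sign.+ ∷ π) t (_ ∷ (_ , q) ∷ _) =
  ℕ.1+n≰n (ℕ.+-cancelˡ-≤ j 1 0 (ℤ.drop‿+≤+ q))
strip⇒walk j (suc r) (Sign.+ ∷ π) t ps = strip⇒walk (suc j) r π
  (trans (sym (up-eq j (total π))) t)
  (All.map (λ {s} → Equivalence.to (strip-↑ j r s)) (partialSums-∷⁻ Sign.+ π ps))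
strip⇒walk zero r (Sign.- ∷ π) t (_ ∷ (() , _) ∷ _)
strip⇒walk (suc j) r (Sign.- ∷ π) t ps = strip⇒walk j (suc r) π
  (trans (sym (down-eq j (total π))) t)
  (All.map (λ {s} → Equivalence.to (strip-↓ j r s)) (partialSums-∷⁻ Sign.- π ps))

-- Heights as natural numbers, and windows of heights

η : Path → ℕ
η π = ∣ height π ∣

maximum : List ℤ → ℤ
maximum = List.foldr ℤ._⊔_ 0ℤ

maximum-≥0 : ∀ xs → 0ℤ ℤ.≤ maximum xs
maximum-≥0 []       = ℤ.≤-refl
maximum-≥0 (x ∷ xs) = ℤ.≤-trans (maximum-≥0 xs) (ℤ.i≤j⊔i x _)

maximum-≤⁻ : ∀ {u} xs → maximum xs ℤ.≤ u → All (ℤ._≤ u) xs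
maximum-≤⁻ []       _ = []
maximum-≤⁻ (x ∷ xs) p =
  ℤ.≤-trans (ℤ.i≤i⊔j x _) p ∷ maximum-≤⁻ xs (ℤ.≤-trans (ℤ.i≤j⊔i x _) p)

maximum-≤⁺ : ∀ {u} xs → 0ℤ ℤ.≤ u → All (ℤ._≤ u) xs → maximum xs ℤ.≤ u
maximum-≤⁺ []       0≤u []       = 0≤u
maximum-≤⁺ (x ∷ xs) 0≤u (p ∷ ps) = ℤ.⊔-lub p (maximum-≤⁺ xs 0≤u ps)

+η : ∀ π → + η π ≡ height π
+η π = ℤ.0≤i⇒+∣i∣≡i (maximum-≥0 (partialSums π))

η≤⁺ : ∀ π {u} → All (ℤ._≤ + u) (partialSums π) → η π ℕ.≤ u
η≤⁺ π {u} ps = ℤ.drop‿+≤+ (subst (ℤ._≤ + u) (sym (+η π)) (maximum-≤⁺ (partialSums π) (ℤ.+≤+ z≤n) ps))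

η≤⁻ : ∀ π {u} → η π ℕ.≤ u → All (ℤ._≤ + u) (partialSums π)
η≤⁻ π {u} p = maximum-≤⁻ (partialSums π) (subst (ℤ._≤ + u) (+η π) (ℤ.+≤+ p))

η≤length : ∀ π → η π ℕ.≤ length π
η≤length π = η≤⁺ π (go π)
  where
  go : ∀ π → All (ℤ._≤ + length π) (partialSums π)
  go [] = ℤ.≤-refl ∷ []
  go (σ ∷ π) = partialSums-∷⁺ σ π (ℤ.+≤+ z≤n) (All.map (ℤ.+-mono-≤ (step σ)) (go π))
    where
    step : ∀ σ → (σ ℤ.◃ 1) ℤ.≤ 1ℤ
    step Sign.+ = ℤ.≤-refl
    step Sign.- = ℤ.-≤+

-- Half-open, so that windows starting at 0 are counted by `bounded` and any other window by a
-- difference of two of its values, with `l = u` as the empty window.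
InWindow : (l u : ℕ) → Path → Set
InWindow l u π = IsDyck π × l ℕ.≤ η π × η π ℕ.< u

inWindow? : ∀ l u → Decidable (InWindow l u)
inWindow? l u π = isDyck? π ×-dec (l ℕ.≤? η π) ×-dec (suc (η π) ℕ.≤? u)

walk⇒inWindow : ∀ h π → Walk 0 h π → InWindow 0 (suc h) π
walk⇒inWindow h π w with walk⇒strip 0 h π w
... | t , ps = (trans (sym (ℤ.+-identityˡ (total π))) t ,
    All.map (λ {s} (p , _) → subst (0ℤ ℤ.≤_) (ℤ.+-identityˡ s) p) ps)
  , z≤n , s≤s (η≤⁺ π (All.map (λ {s} (_ , q) → subst (ℤ._≤ + h) (ℤ.+-identityˡ s) q) ps))

inWindow⇒walk : ∀ h π → InWindow 0 (suc h) π → Walk 0 h π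
inWindow⇒walk h π ((t , ps) , _ , s≤s η≤h) = strip⇒walk 0 h π (trans (ℤ.+-identityˡ (total π)) t)
  (All.zipWith (λ {s} (p , q) → subst (0ℤ ℤ.≤_) (sym (ℤ.+-identityˡ s)) p ,
                          subst (ℤ._≤ + h) (sym (ℤ.+-identityˡ s)) q) (ps , η≤⁻ π η≤h))

-- Tuples with heights in a window

inWindow-split : ∀ {l u} → l ℕ.≤ u → ∀ π →
  ⟦ inWindow? l u π ⟧ ≡ ⟦ inWindow? 0 u π ⟧ ℤ.- ⟦ inWindow? 0 l π ⟧
inWindow-split {l} {u} l≤u π with ℕ.<-≤-connex (η π) l
... | inj₂ l≤η = begin-≡
    ⟦ inWindow? l u π ⟧
      ≡⟨ ⟦⟧-cong (λ (d , _ , q) → d , z≤n , q) (λ (d , _ , q) → d , l≤η , q)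
           (inWindow? l u π) (inWindow? 0 u π) ⟩
    ⟦ inWindow? 0 u π ⟧
      ≡⟨ ℤ.+-identityʳ _ ⟨
    ⟦ inWindow? 0 u π ⟧ ℤ.- 0ℤ
      ≡⟨ cong (ℤ._-_ ⟦ inWindow? 0 u π ⟧) (⟦⟧-no (inWindow? 0 l π) λ (_ , _ , η<l) → ℕ.<⇒≱ η<l l≤η) ⟨
    ⟦ inWindow? 0 u π ⟧ ℤ.- ⟦ inWindow? 0 l π ⟧ ∎-≡
... | inj₁ η<l = begin-≡
    ⟦ inWindow? l u π ⟧
      ≡⟨ ⟦⟧-no (inWindow? l u π) (λ (_ , l≤η , _) → ℕ.<⇒≱ η<l l≤η) ⟩
    0ℤ
      ≡⟨ ℤ.+-inverseʳ ⟦ inWindow? 0 l π ⟧ ⟨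
    ⟦ inWindow? 0 l π ⟧ ℤ.- ⟦ inWindow? 0 l π ⟧
      ≡⟨ cong (λ i → i ℤ.- ⟦ inWindow? 0 l π ⟧)
           (⟦⟧-cong (λ (d , p , q) → d , p , ℕ.≤-trans q l≤u) (λ (d , p , _) → d , p , η<l)
             (inWindow? 0 l π) (inWindow? 0 u π)) ⟩
    ⟦ inWindow? 0 u π ⟧ ℤ.- ⟦ inWindow? 0 l π ⟧ ∎-≡

const-cong : ∀ {c d} → c ≡ d → const c ≈ const d
const-cong refl = 𝕊.refl

weight-cong : ∀ {P Q : Path → Set} (P? : Decidable P) (Q? : Decidable Q) →
  (∀ π → ⟦ P? π ⟧ ≡ ⟦ Q? π ⟧) → ∀ π → weight P? π ≈ weight Q? π
weight-cong P? Q? eq π = 𝕊.*-congʳ (const-cong (eq π))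

sum-bounded : ∀ L h → sumOver (pathsUpTo L) (weight (inWindow? 0 h)) ≈[ L ] bounded h
sum-bounded L zero    = ≈⇒≈[] (𝕊.trans
  (sumOver-cong (weight-cong (inWindow? 0 0) never?
    (λ π → ⟦⟧-no (inWindow? 0 0 π) λ { (_ , _ , ()) })) (pathsUpTo L))
  (𝕊.trans (sum-never L) const-0))
sum-bounded L (suc h) = ≈[]-trans
  (≈⇒≈[] (sumOver-cong (weight-cong (inWindow? 0 (suc h)) (walk? 0 h)
    (λ π → ⟦⟧-cong (inWindow⇒walk h π) (walk⇒inWindow h π)
           (inWindow? 0 (suc h) π) (walk? 0 h π))) (pathsUpTo L)))
  (sum-walks L 0 h)

sum-inWindow : ∀ L {l u} → l ℕ.≤ u →
  sumOver (pathsUpTo L) (weight (inWindow? l u)) ≈[ L ] bounded u - bounded l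
sum-inWindow L {l} {u} l≤u = ≈[]-trans
  (≈⇒≈[] (𝕊.trans (sumOver-cong split (pathsUpTo L))
    (sumOver-- (weight (inWindow? 0 u)) (weight (inWindow? 0 l)) (pathsUpTo L))))
  (⊕-cong≤ (sum-bounded L u) (⊖-cong≤ (sum-bounded L l)))
  where
  split : ∀ π → weight (inWindow? l u) π ≈ weight (inWindow? 0 u) π - weight (inWindow? 0 l) π
  split π = begin
    const ⟦ inWindow? l u π ⟧ ⊛ z ^ length π
      ≈⟨ 𝕊.*-congʳ (const-cong (inWindow-split l≤u π)) ⟩
    const (⟦ inWindow? 0 u π ⟧ ℤ.- ⟦ inWindow? 0 l π ⟧) ⊛ z ^ length π
      ≈⟨ 𝕊.*-congʳ (𝕊.trans (const-⊕ _ _) (𝕊.+-congˡ (const-⊖ _))) ⟩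
    (const ⟦ inWindow? 0 u π ⟧ - const ⟦ inWindow? 0 l π ⟧) ⊛ z ^ length π
      ≈⟨ solve 3 (λ a b e → (a :- b) :* e := a :* e :- b :* e) 𝕊.refl _ _ _ ⟩
    weight (inWindow? 0 u) π - weight (inWindow? 0 l) π ∎

totalLength : ∀ {m} → Vec Path m → ℕ
totalLength πs = Vec.sum (Vec.map length πs)


prodOver-weight : ∀ {P : Path → Set} (P? : Decidable P) {m} (πs : Vec Path m) →
  prodOver (weight P?) πs ≈ const ⟦ VecAll.all? P? πs ⟧ ⊛ z ^ totalLength πs
prodOver-weight P? []       = 𝕊.sym (𝕊.*-identityˡ _)
prodOver-weight P? (π ∷ πs) = begin
  weight P? π ⊛ prodOver (weight P?) πs
    ≈⟨ 𝕊.*-congˡ (prodOver-weight P? πs) ⟩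
  (const ⟦ P? π ⟧ ⊛ z ^ length π) ⊛ (const ⟦ VecAll.all? P? πs ⟧ ⊛ z ^ totalLength πs)
    ≈⟨ solve 4 (λ a e b f → (a :* e) :* (b :* f) := (a :* b) :* (e :* f)) 𝕊.refl _ _ _ _ ⟩
  (const ⟦ P? π ⟧ ⊛ const ⟦ VecAll.all? P? πs ⟧) ⊛ (z ^ length π ⊛ z ^ totalLength πs)
    ≈⟨ 𝕊.*-cong (𝕊.sym (const-⊛ _ _)) (𝕊.sym (^-homo-* z (length π) (totalLength πs))) ⟩
  const (⟦ P? π ⟧ ℤ.* ⟦ VecAll.all? P? πs ⟧) ⊛ z ^ totalLength (π ∷ πs)
    ≈⟨ 𝕊.*-congʳ (const-cong (trans (sym (⟦⟧-× (P? π) (VecAll.all? P? πs)))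
         (⟦⟧-cong (λ (p , ps) → p ∷ ps) VecAll.uncons
           (P? π ×-dec VecAll.all? P? πs) (VecAll.all? P? (π ∷ πs))))) ⟩
  const ⟦ VecAll.all? P? (π ∷ πs) ⟧ ⊛ z ^ totalLength (π ∷ πs) ∎

AllInWindow : (l u N : ℕ) {m : ℕ} → Vec Path m → Set
AllInWindow l u N πs = VecAll.All (InWindow l u) πs × totalLength πs ≡ N

allInWindow? : ∀ l u N {m} → Decidable (AllInWindow l u N {m})
allInWindow? l u N πs = VecAll.all? (inWindow? l u) πs ×-dec (totalLength πs ℕ.≟ N)

-- One `N` serves as bound for the listed paths and as the degree read off: the sum over these paths
-- is correct up to degree `N`, and coefficient `N` of its power needs no more.
count-allInWindow : ∀ {l u} → l ℕ.≤ u → ∀ N m →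
  count (allInWindow? l u N) (tuples m (pathsUpTo N)) ≡ ((bounded u - bounded l) ^ m) N
count-allInWindow {l} {u} l≤u N m = trans
  (sym (sumOver-coeff (allInWindow? l u N) coeff-prodOver (tuples m (pathsUpTo N))))
  (trans (coeff (sumOver-tuples (weight (inWindow? l u)) m (pathsUpTo N)) N)
    (coeff≤ (^-cong≤ m (sum-inWindow N l≤u)) N ℕ.≤-refl))
  where
  coeff-prodOver : ∀ (πs : Vec Path m) →
    prodOver (weight (inWindow? l u)) πs N ≡ ⟦ allInWindow? l u N πs ⟧
  coeff-prodOver πs = trans (coeff (prodOver-weight (inWindow? l u) πs) N)
    (trans (const-⊛-coeff _ _ N)
      (trans (cong (ℤ._*_ ⟦ VecAll.all? (inWindow? l u) πs ⟧) (z^-coeff (totalLength πs) N))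
        (sym (⟦⟧-× (VecAll.all? (inWindow? l u) πs) (totalLength πs ℕ.≟ N)))))

distance : ∀ a b → ∣ + a ℤ.- + b ∣ ≡ ℕ.∣ a - b ∣
distance a b = trans (cong ∣_∣ (ℤ.m-n≡m⊖n a b)) (go a b)
  where
  go : ∀ a b → ∣ a ℤ.⊖ b ∣ ≡ ℕ.∣ a - b ∣
  go zero    zero    = refl
  go zero    (suc b) = refl
  go (suc a) zero    = refl
  go (suc a) (suc b) = trans (cong ∣_∣ (ℤ.[1+m]⊖[1+n]≡m⊖n a b)) (go a b)

∣-∣≤⁺ : ∀ {a b k} → a ℕ.≤ k ℕ.+ b → b ℕ.≤ k ℕ.+ a → ℕ.∣ a - b ∣ ℕ.≤ k
∣-∣≤⁺ {a} {b} {k} p q with ℕ.≤-total a b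
... | inj₁ a≤b = subst (ℕ._≤ k) (sym (ℕ.m≤n⇒∣m-n∣≡n∸m a≤b))
  (ℕ.m≤n+o⇒m∸n≤o b a (subst (b ℕ.≤_) (ℕ.+-comm k a) q))
... | inj₂ b≤a = subst (ℕ._≤ k) (sym (ℕ.m≤n⇒∣n-m∣≡n∸m b≤a))
  (ℕ.m≤n+o⇒m∸n≤o a b (subst (a ℕ.≤_) (ℕ.+-comm k b) p))

∣-∣≤⁻ : ∀ {a b k} → ℕ.∣ a - b ∣ ℕ.≤ k → a ℕ.≤ k ℕ.+ b
∣-∣≤⁻ {a} {b} {k} p = ℕ.≤-trans (ℕ.m≤n+∣m-n∣ a b)
  (subst (b ℕ.+ ℕ.∣ a - b ∣ ℕ.≤_) (ℕ.+-comm b k) (ℕ.+-monoʳ-≤ b p))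

height-distance : ∀ π π′ → ∣ height π ℤ.- height π′ ∣ ≡ ℕ.∣ η π - η π′ ∣
height-distance π π′ = trans
  (cong₂ (λ a b → ∣ a ℤ.- b ∣) (sym (+η π)) (sym (+η π′))) (distance (η π) (η π′))

module _ (n : ℕ) {m : ℕ} (k : ℕ) where

  -- What satisfies this for `h` but not for `suc h` has least height exactly `h`, so counts by
  -- least height are differences that telescope.
  AdmissibleAbove : (h : ℕ) → Vec Path m → Set
  AdmissibleAbove h πs = Admissible (+ n) m k πs × VecAll.All (λ π → h ℕ.≤ η π) πs

  admissibleAbove? : ∀ h → Decidable (AdmissibleAbove h)
  admissibleAbove? h πs = admissible? (+ n) m k πs ×-dec VecAll.all? (λ π → h ℕ.≤? η π) πs

  inWindow⇒admissibleAbove : ∀ h πs → AllInWindow h (k ℕ.+ suc h) (2 ℕ.* n) πs → AdmissibleAbove h πs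
  inWindow⇒admissibleAbove h πs (ws , len) =
    (VecAll.map proj₁ ws , trans (cong +_ len) (ℤ.pos-* 2 n) , close) , VecAll.map (proj₁ ∘ proj₂) ws
    where
    below : ∀ i j → η (lookup πs i) ℕ.≤ k ℕ.+ η (lookup πs j)
    below i j = ℕ.≤-pred (ℕ.≤-trans (proj₂ (proj₂ (lookup⁺ ws i)))
      (subst (k ℕ.+ suc h ℕ.≤_) (ℕ.+-suc k _) (ℕ.+-monoʳ-≤ k (s≤s (proj₁ (proj₂ (lookup⁺ ws j)))))))
    close : ∀ i j → ∣ height (lookup πs i) ℤ.- height (lookup πs j) ∣ ℕ.≤ k
    close i j = subst (ℕ._≤ k) (sym (height-distance (lookup πs i) (lookup πs j)))
      (∣-∣≤⁺ (below i j) (below j i))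

  -- The path found by `low` has height at most `h`, and no other height exceeds it by more than
  -- `k`.
  admissibleAbove⇒inWindow : ∀ h πs → VecAny.Any (λ π → η π ℕ.≤ h) πs →
    AdmissibleAbove h πs → AllInWindow h (k ℕ.+ suc h) (2 ℕ.* n) πs
  admissibleAbove⇒inWindow h πs low ((ds , len , close) , above) =
    lookup⁻ (λ i → lookup⁺ ds i , lookup⁺ above i , below i) ,
    ℤ.+-injective (trans len (sym (ℤ.pos-* 2 n)))
    where
    below : ∀ i → η (lookup πs i) ℕ.< k ℕ.+ suc h
    below i = subst (suc (η (lookup πs i)) ℕ.≤_) (sym (ℕ.+-suc k h)) (s≤s (ℕ.≤-trans
      (∣-∣≤⁻ (subst (ℕ._≤ k) (height-distance (lookup πs i) (lookup πs (VecAny.index low)))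
              (close i (VecAny.index low))))
      (ℕ.+-monoʳ-≤ k (lookup-index low))))
      where
      lookup-index : ∀ {m} {πs : Vec Path m} (p : VecAny.Any (λ π → η π ℕ.≤ h) πs) →
        η (lookup πs (VecAny.index p)) ℕ.≤ h
      lookup-index (VecAny.here p)  = p
      lookup-index (VecAny.there p) = lookup-index p

  -- Either every height exceeds h, and both differences vanish, or
  -- some height is at most h, and both subtracted terms vanish.
  window-difference : ∀ h πs →
    ⟦ allInWindow? h (k ℕ.+ suc h) (2 ℕ.* n) πs ⟧
      ℤ.- ⟦ allInWindow? (suc h) (k ℕ.+ suc h) (2 ℕ.* n) πs ⟧
    ≡ ⟦ admissibleAbove? h πs ⟧ ℤ.- ⟦ admissibleAbove? (suc h) πs ⟧
  window-difference h πs with VecAll.decide (λ π → ℕ.<-≤-connex h (η π)) πs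
  ... | inj₁ above = trans
    (trans (cong (λ i → i ℤ.- ⟦ B? ⟧) (⟦⟧-cong
      (λ (ws , len) → VecAll.map (λ ((d , _ , q) , p) → d , p , q) (VecAll.zip (ws , above)) , len)
      (λ (ws , len) → VecAll.map (λ (d , p , q) → d , ℕ.<⇒≤ p , q) ws , len) A? B?))
      (ℤ.+-inverseʳ ⟦ B? ⟧))
    (sym (trans (cong (λ i → i ℤ.- ⟦ L?′ ⟧) (⟦⟧-cong (λ (a , _) → a , above)
      (λ (a , p) → a , VecAll.map ℕ.<⇒≤ p) L? L?′)) (ℤ.+-inverseʳ ⟦ L?′ ⟧)))
    where
    A? = allInWindow? h (k ℕ.+ suc h) (2 ℕ.* n) πs
    B? = allInWindow? (suc h) (k ℕ.+ suc h) (2 ℕ.* n) πs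
    L? = admissibleAbove? h πs
    L?′ = admissibleAbove? (suc h) πs
  ... | inj₂ low = cong₂ ℤ._-_
    (⟦⟧-cong (inWindow⇒admissibleAbove h πs) (admissibleAbove⇒inWindow h πs low)
      (allInWindow? h (k ℕ.+ suc h) (2 ℕ.* n) πs) (admissibleAbove? h πs))
    (trans (⟦⟧-no (allInWindow? (suc h) (k ℕ.+ suc h) (2 ℕ.* n) πs)
        (λ (ws , _) → not-above (VecAll.map (proj₁ ∘ proj₂) ws)))
      (sym (⟦⟧-no (admissibleAbove? (suc h) πs) (not-above ∘ proj₂))))
    where
    not-above : ¬ VecAll.All (λ π → h ℕ.< η π) πs
    not-above above = VecAll.lookupWith (λ h<η η≤h → ℕ.<⇒≱ h<η η≤h) above low

windowSeries : (m k h : ℕ) → Series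
windowSeries m k h =
  (bounded (k ℕ.+ suc h) - bounded h) ^ m - (bounded (k ℕ.+ suc h) - bounded (suc h)) ^ m

sumBelow : ℕ → (ℕ → Series) → Series
sumBelow zero    f = const 0ℤ
sumBelow (suc H) f = sumBelow H f ⊕ f H

-- The sum telescopes to `above 0` minus `above H`. The former counts all admissible tuples; the
-- latter vanishes because a path is at least as long as it is high. This takes a nonempty tuple,
-- since the empty one lies above every height.
G-coeff : ∀ n m k {H} → 2 ℕ.* n ℕ.< H →
  + G (+ n) (suc m) k ≡ sumBelow H (windowSeries (suc m) k) (2 ℕ.* n)
G-coeff n m k {H} 2n<H = begin-≡
  + G (+ n) (suc m) k
    ≡⟨ length-filter (admissible? (+ n) (suc m) k) (tuples (suc m) (pathsUpTo ∣ + 2 ℤ.* + n ∣)) ⟩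
  count (admissible? (+ n) (suc m) k) (tuples (suc m) (pathsUpTo ∣ + 2 ℤ.* + n ∣))
    ≡⟨ cong (λ L → count (admissible? (+ n) (suc m) k) (tuples (suc m) (pathsUpTo L)))
         (cong ∣_∣ (ℤ.pos-* 2 n)) ⟨
  count (admissible? (+ n) (suc m) k) ts
    ≡⟨ count-cong (admissible? (+ n) (suc m) k) (admissibleAbove? n k 0)
         (λ πs → ⟦⟧-cong (λ a → a , VecAll.universal (λ _ → z≤n) πs) proj₁
           (admissible? (+ n) (suc m) k πs) (admissibleAbove? n k 0 πs)) ts ⟩
  above 0
    ≡⟨ ℤ.+-identityʳ (above 0) ⟨
  above 0 ℤ.- 0ℤ
    ≡⟨ cong (ℤ._-_ (above 0)) (count-none (admissibleAbove? n k H)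
         (λ πs → ⟦⟧-no (admissibleAbove? n k H πs) (too-high πs)) ts) ⟨
  above 0 ℤ.- above H
    ≡⟨ telescope H ⟨
  sumBelow H (windowSeries (suc m) k) (2 ℕ.* n) ∎-≡
  where
  ts : List (Vec Path (suc m))
  ts = tuples (suc m) (pathsUpTo (2 ℕ.* n))
  above : ℕ → ℤ
  above h = count (admissibleAbove? n k h) ts
  too-high : ∀ πs → ¬ AdmissibleAbove n k H πs
  too-high (π ∷ πs) ((_ , len , _) , (H≤η ∷ _)) = ℕ.<⇒≱ 2n<H (ℕ.≤-trans H≤η (ℕ.≤-trans (η≤length π)
    (ℕ.≤-trans (ℕ.m≤m+n (length π) (totalLength πs))
      (ℕ.≤-reflexive (ℤ.+-injective (trans len (sym (ℤ.pos-* 2 n))))))))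
  window-coeff : ∀ h → windowSeries (suc m) k h (2 ℕ.* n) ≡ above h ℤ.- above (suc h)
  window-coeff h = trans (minus-coeff _ _ (2 ℕ.* n)) (trans
    (sym (cong₂ ℤ._-_
      (count-allInWindow (ℕ.≤-trans (ℕ.n≤1+n h) (ℕ.m≤n+m (suc h) k)) (2 ℕ.* n) (suc m))
      (count-allInWindow (ℕ.m≤n+m (suc h) k) (2 ℕ.* n) (suc m))))
    (count-diff (allInWindow? h (k ℕ.+ suc h) (2 ℕ.* n)) (allInWindow? (suc h) (k ℕ.+ suc h) (2 ℕ.* n))
      (admissibleAbove? n k h) (admissibleAbove? n k (suc h)) (window-difference n k h) ts))
  telescope : ∀ H → sumBelow H (windowSeries (suc m) k) (2 ℕ.* n) ≡ above 0 ℤ.- above H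
  telescope zero    = trans (trans (const-0-coeff (2 ℕ.* n)) refl) (sym (ℤ.+-inverseʳ (above 0)))
    where
    const-0-coeff : ∀ n → const 0ℤ n ≡ 0ℤ
    const-0-coeff n = sym (coeff const-0 n)
  telescope (suc H) = trans (⊕-coeff _ _ (2 ℕ.* n))
    (trans (cong₂ ℤ._+_ (telescope H) (window-coeff H)) (lemma (above 0) (above H) (above (suc H))))
    where
    lemma : ∀ a b c → (a ℤ.- b) ℤ.+ (b ℤ.- c) ≡ a ℤ.- c
    lemma = solve-∀

-- Catalan numbers and T(4, n)

-- With `k * 2` instead of `2 * k`, the index of the successor computes to `2 + k * 2`, which is how
-- multiplication by X shifts coefficients.
catalan : ℕ → ℕ
catalan k = walks 0 (k * 2) (k * 2)

-- Coefficient `2 + k * 2` of `catalan-ode`. The common factor 2 that is cancelled comes from θ,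
-- which weighs by length and not by half the length.
catalan-rec : ∀ k → (2 + k) * catalan (suc k) ≡ 2 * (1 + 2 * k) * catalan k
catalan-rec k = ℕ.*-cancelˡ-≡ _ _ 2 (ℤ.+-injective (begin-≡
  + (2 * ((2 + k) * c′))
    ≡⟨ cong +_ (lemma₁ k c′) ⟩
  + ((2 + k * 2) * c′ + 2 * c′)
    ≡⟨ cong₂ ℤ._+_ (ℤ.pos-* (2 + k * 2) c′) (ℤ.pos-* 2 c′) ⟩
  θ dyck (2 + n) ℤ.+ + 2 ℤ.* dyck (2 + n)
    ≡⟨ cong (ℤ._+_ (θ dyck (2 + n))) (const-⊛-coeff (+ 2) dyck (2 + n)) ⟨
  θ dyck (2 + n) ℤ.+ (const (+ 2) ⊛ dyck) (2 + n)
    ≡⟨ ⊕-coeff _ _ (2 + n) ⟨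
  (θ dyck ⊕ const (+ 2) ⊛ dyck) (2 + n)
    ≡⟨ coeff (catalan-ode dyck dyck-eq) (2 + n) ⟩
  (const (+ 2) ⊕ const (+ 4) ⊛ (X ⊛ (dyck ⊕ θ dyck))) (2 + n)
    ≡⟨ ⊕-coeff _ _ (2 + n) ⟩
  0ℤ ℤ.+ (const (+ 4) ⊛ (X ⊛ (dyck ⊕ θ dyck))) (2 + n)
    ≡⟨ ℤ.+-identityˡ _ ⟩
  (const (+ 4) ⊛ (X ⊛ (dyck ⊕ θ dyck))) (2 + n)
    ≡⟨ const-⊛-coeff (+ 4) _ (2 + n) ⟩
  + 4 ℤ.* (X ⊛ (dyck ⊕ θ dyck)) (2 + n)
    ≡⟨ cong (ℤ._*_ (+ 4)) (trans (X-⊛-coeff _ n) (⊕-coeff _ _ n)) ⟩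
  + 4 ℤ.* (+ c ℤ.+ + n ℤ.* + c)
    ≡⟨ cong (λ i → + 4 ℤ.* (+ c ℤ.+ i)) (ℤ.pos-* n c) ⟨
  + 4 ℤ.* + (c + n * c)
    ≡⟨ ℤ.pos-* 4 (c + n * c) ⟨
  + (4 * (c + n * c))
    ≡⟨ cong +_ (lemma₂ k c) ⟩
  + (2 * (2 * (1 + 2 * k) * c)) ∎-≡))
  where
  n c c′ : ℕ
  n  = k * 2
  c  = catalan k
  c′ = catalan (suc k)
  lemma₁ : ∀ k c → 2 * ((2 + k) * c) ≡ (2 + k * 2) * c + 2 * c
  lemma₁ = ℕSolver.solve-∀
  lemma₂ : ∀ k c → 4 * (c + (k * 2) * c) ≡ 2 * (2 * (1 + 2 * k) * c)
  lemma₂ = ℕSolver.solve-∀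

catalan-closed : ∀ k → catalan k * (k ! * suc k !) ≡ (2 * k) !
catalan-closed zero    = refl
catalan-closed (suc k) = begin-≡
  c′ * ((suc k * k !) * ((2 + k) * suc k !))
    ≡⟨ lemma₁ k c′ (k !) (suc k !) ⟩
  (2 + k) * c′ * (suc k * (k ! * suc k !))
    ≡⟨ cong (_* (suc k * (k ! * suc k !))) (catalan-rec k) ⟩
  2 * (1 + 2 * k) * c * (suc k * (k ! * suc k !))
    ≡⟨ lemma₂ k c (k ! * suc k !) ⟩
  (2 + 2 * k) * ((1 + 2 * k) * (c * (k ! * suc k !)))
    ≡⟨ cong (λ f → (2 + 2 * k) * ((1 + 2 * k) * f)) (catalan-closed k) ⟩
  (2 + 2 * k) !
    ≡⟨ cong _! (ℕ.*-distribˡ-+ 2 1 k) ⟨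
  (2 * suc k) ! ∎-≡
  where
  c c′ : ℕ
  c  = catalan k
  c′ = catalan (suc k)
  lemma₁ : ∀ k c f g → c * ((suc k * f) * ((2 + k) * g)) ≡ (2 + k) * c * (suc k * (f * g))
  lemma₁ = ℕSolver.solve-∀
  lemma₂ : ∀ k c f → 2 * (1 + 2 * k) * c * (suc k * f) ≡ (2 + 2 * k) * ((1 + 2 * k) * (c * f))
  lemma₂ = ℕSolver.solve-∀

-- The combination comes from 4 T(m,n) = T(m+1,n) + T(m,n+1), iterated from
-- T(1,n) = catalan n.
superCatalan : ∀ n {x} →
  + x ≡ + 64 ℤ.* + catalan n ℤ.- + 48 ℤ.* + catalan (1 + n) ℤ.+ + 12 ℤ.* + catalan (2 + n) ℤ.- + catalan (3 + n) →
  x * ((2 + n) * (3 + n) * (4 + n)) ≡ 840 * catalan n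
superCatalan n {x} eq = ℤ.+-injective (begin-≡
  + (x * ((2 + n) * (3 + n) * (4 + n)))
    ≡⟨ trans (ℤ.pos-* x _) (cong (ℤ._*_ (+ x)) (trans (ℤ.pos-* ((2 + n) * (3 + n)) (4 + n))
         (cong (λ i → i ℤ.* + (4 + n)) (ℤ.pos-* (2 + n) (3 + n))))) ⟩
  + x ℤ.* (+ (2 + n) ℤ.* + (3 + n) ℤ.* + (4 + n))
    ≡⟨ cong (λ i → i ℤ.* (+ (2 + n) ℤ.* + (3 + n) ℤ.* + (4 + n))) eq ⟩
  _ ≡⟨ combine (+ n) (+ catalan n) (+ catalan (1 + n)) (+ catalan (2 + n)) (+ catalan (3 + n))
         (rec n) (rec (1 + n)) (rec (2 + n)) ⟩
  + 840 ℤ.* + catalan n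
    ≡⟨ ℤ.pos-* 840 (catalan n) ⟨
  + (840 * catalan n) ∎-≡)
  where
  rec : ∀ k → + (2 + k) ℤ.* + catalan (1 + k) ≡ + 2 ℤ.* (1ℤ ℤ.+ + 2 ℤ.* + k) ℤ.* + catalan k
  rec k = begin-≡
    + (2 + k) ℤ.* + catalan (1 + k)            ≡⟨ ℤ.pos-* (2 + k) (catalan (1 + k)) ⟨
    + ((2 + k) * catalan (1 + k))              ≡⟨ cong +_ (catalan-rec k) ⟩
    + (2 * (1 + 2 * k) * catalan k)            ≡⟨ ℤ.pos-* (2 * (1 + 2 * k)) (catalan k) ⟩
    + (2 * (1 + 2 * k)) ℤ.* + catalan k        ≡⟨ cong (λ i → i ℤ.* + catalan k) (ℤ.pos-* 2 (1 + 2 * k)) ⟩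
    + 2 ℤ.* (1ℤ ℤ.+ + (2 * k)) ℤ.* + catalan k ≡⟨ cong (λ i → + 2 ℤ.* (1ℤ ℤ.+ i) ℤ.* + catalan k) (ℤ.pos-* 2 k) ⟩
    + 2 ℤ.* (1ℤ ℤ.+ + 2 ℤ.* + k) ℤ.* + catalan k ∎-≡
  -- The recursions eliminate c₃, c₂ and c₁ in turn. The factor 38 + 8n is 12 (4 + n) - 2 (5 + 2n),
  -- left at c₂ after the first elimination; in the last step all positive powers of n cancel.
  combine : ∀ n c₀ c₁ c₂ c₃ →
    (+ 2 ℤ.+ n) ℤ.* c₁ ≡ + 2 ℤ.* (1ℤ ℤ.+ + 2 ℤ.* n) ℤ.* c₀ →
    (+ 3 ℤ.+ n) ℤ.* c₂ ≡ + 2 ℤ.* (1ℤ ℤ.+ + 2 ℤ.* (1ℤ ℤ.+ n)) ℤ.* c₁ →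
    (+ 4 ℤ.+ n) ℤ.* c₃ ≡ + 2 ℤ.* (1ℤ ℤ.+ + 2 ℤ.* (+ 2 ℤ.+ n)) ℤ.* c₂ →
    (+ 64 ℤ.* c₀ ℤ.- + 48 ℤ.* c₁ ℤ.+ + 12 ℤ.* c₂ ℤ.- c₃) ℤ.* ((+ 2 ℤ.+ n) ℤ.* (+ 3 ℤ.+ n) ℤ.* (+ 4 ℤ.+ n))
    ≡ + 840 ℤ.* c₀
  combine n c₀ c₁ c₂ c₃ r₁ r₂ r₃ = begin-≡
    _ ≡⟨ step₃ n c₀ c₁ c₂ c₃ ⟩
    _ ≡⟨ cong (λ i → (+ 64 ℤ.* c₀ ℤ.- + 48 ℤ.* c₁ ℤ.+ + 12 ℤ.* c₂) ℤ.* ((+ 2 ℤ.+ n) ℤ.* (+ 3 ℤ.+ n) ℤ.* (+ 4 ℤ.+ n))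
                     ℤ.- (+ 2 ℤ.+ n) ℤ.* (+ 3 ℤ.+ n) ℤ.* i) r₃ ⟩
    _ ≡⟨ step₂ n c₀ c₁ c₂ ⟩
    _ ≡⟨ cong (λ i → (+ 64 ℤ.* c₀ ℤ.- + 48 ℤ.* c₁) ℤ.* ((+ 2 ℤ.+ n) ℤ.* (+ 3 ℤ.+ n) ℤ.* (+ 4 ℤ.+ n))
                     ℤ.+ (+ 2 ℤ.+ n) ℤ.* (+ 38 ℤ.+ + 8 ℤ.* n) ℤ.* i) r₂ ⟩
    _ ≡⟨ step₁ n c₀ c₁ ⟩
    _ ≡⟨ cong (λ i → + 64 ℤ.* c₀ ℤ.* ((+ 2 ℤ.+ n) ℤ.* (+ 3 ℤ.+ n) ℤ.* (+ 4 ℤ.+ n))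
                     ℤ.+ (+ 2 ℤ.* (+ 3 ℤ.+ + 2 ℤ.* n) ℤ.* (+ 38 ℤ.+ + 8 ℤ.* n)
          ℤ.- + 48 ℤ.* ((+ 3 ℤ.+ n) ℤ.* (+ 4 ℤ.+ n))) ℤ.* i) r₁ ⟩
    _ ≡⟨ step₀ n c₀ ⟩
    _ ∎-≡
    where
    step₃ : ∀ n c₀ c₁ c₂ c₃ →
      (+ 64 ℤ.* c₀ ℤ.- + 48 ℤ.* c₁ ℤ.+ + 12 ℤ.* c₂ ℤ.- c₃) ℤ.* ((+ 2 ℤ.+ n) ℤ.* (+ 3 ℤ.+ n) ℤ.* (+ 4 ℤ.+ n))
      ≡ (+ 64 ℤ.* c₀ ℤ.- + 48 ℤ.* c₁ ℤ.+ + 12 ℤ.* c₂) ℤ.* ((+ 2 ℤ.+ n) ℤ.* (+ 3 ℤ.+ n) ℤ.* (+ 4 ℤ.+ n))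
        ℤ.- (+ 2 ℤ.+ n) ℤ.* (+ 3 ℤ.+ n) ℤ.* ((+ 4 ℤ.+ n) ℤ.* c₃)
    step₃ = solve-∀
    step₂ : ∀ n c₀ c₁ c₂ →
      (+ 64 ℤ.* c₀ ℤ.- + 48 ℤ.* c₁ ℤ.+ + 12 ℤ.* c₂) ℤ.* ((+ 2 ℤ.+ n) ℤ.* (+ 3 ℤ.+ n) ℤ.* (+ 4 ℤ.+ n))
        ℤ.- (+ 2 ℤ.+ n) ℤ.* (+ 3 ℤ.+ n) ℤ.* (+ 2 ℤ.* (1ℤ ℤ.+ + 2 ℤ.* (+ 2 ℤ.+ n)) ℤ.* c₂)
      ≡ (+ 64 ℤ.* c₀ ℤ.- + 48 ℤ.* c₁) ℤ.* ((+ 2 ℤ.+ n) ℤ.* (+ 3 ℤ.+ n) ℤ.* (+ 4 ℤ.+ n))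
        ℤ.+ (+ 2 ℤ.+ n) ℤ.* (+ 38 ℤ.+ + 8 ℤ.* n) ℤ.* ((+ 3 ℤ.+ n) ℤ.* c₂)
    step₂ = solve-∀
    step₁ : ∀ n c₀ c₁ →
      (+ 64 ℤ.* c₀ ℤ.- + 48 ℤ.* c₁) ℤ.* ((+ 2 ℤ.+ n) ℤ.* (+ 3 ℤ.+ n) ℤ.* (+ 4 ℤ.+ n))
        ℤ.+ (+ 2 ℤ.+ n) ℤ.* (+ 38 ℤ.+ + 8 ℤ.* n) ℤ.* (+ 2 ℤ.* (1ℤ ℤ.+ + 2 ℤ.* (1ℤ ℤ.+ n)) ℤ.* c₁)
      ≡ + 64 ℤ.* c₀ ℤ.* ((+ 2 ℤ.+ n) ℤ.* (+ 3 ℤ.+ n) ℤ.* (+ 4 ℤ.+ n))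
        ℤ.+ (+ 2 ℤ.* (+ 3 ℤ.+ + 2 ℤ.* n) ℤ.* (+ 38 ℤ.+ + 8 ℤ.* n)
          ℤ.- + 48 ℤ.* ((+ 3 ℤ.+ n) ℤ.* (+ 4 ℤ.+ n))) ℤ.* ((+ 2 ℤ.+ n) ℤ.* c₁)
    step₁ = solve-∀
    step₀ : ∀ n c₀ →
      + 64 ℤ.* c₀ ℤ.* ((+ 2 ℤ.+ n) ℤ.* (+ 3 ℤ.+ n) ℤ.* (+ 4 ℤ.+ n))
        ℤ.+ (+ 2 ℤ.* (+ 3 ℤ.+ + 2 ℤ.* n) ℤ.* (+ 38 ℤ.+ + 8 ℤ.* n)
          ℤ.- + 48 ℤ.* ((+ 3 ℤ.+ n) ℤ.* (+ 4 ℤ.+ n))) ℤ.* (+ 2 ℤ.* (1ℤ ℤ.+ + 2 ℤ.* n) ℤ.* c₀)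
      ≡ + 840 ℤ.* c₀
    step₀ = solve-∀

½-* : ∀ {x a} d .{{_ : NonZero d}} → a ≡ 2 * x * d → ½ ℚ.* (+ a ℚ./ d) ≡ + x ℚ./ 1
-- In unnormalised fractions, free of the reduction by the gcd, the claim is a cross multiplication.
½-* {x} {a} (suc d) eq = ℚ.toℚᵘ-injective (ℚᵘ.≃-trans (ℚ.toℚᵘ-homo-* ½ (+ a ℚ./ suc d))
  (ℚᵘ.≃-trans (ℚᵘ.*-congˡ {ℚ.toℚᵘ ½} (ℚ.toℚᵘ-fromℚᵘ (ℚᵘ.mkℚᵘ (+ a) d)))
    (ℚᵘ.≃-trans (ℚᵘ.*≡* cross) (ℚᵘ.≃-sym (ℚ.toℚᵘ-fromℚᵘ (ℚᵘ.mkℚᵘ (+ x) 0))))))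
  where
  cross : (1ℤ ℤ.* + a) ℤ.* 1ℤ ≡ + x ℤ.* + (2 * suc d)
  cross = begin-≡
    (1ℤ ℤ.* + a) ℤ.* 1ℤ ≡⟨ trans (ℤ.*-identityʳ _) (ℤ.*-identityˡ (+ a)) ⟩
    + a                 ≡⟨ cong +_ (trans eq (lemma x (suc d))) ⟩
    + (x * (2 * suc d)) ≡⟨ ℤ.pos-* x (2 * suc d) ⟩
    + x ℤ.* + (2 * suc d) ∎-≡
    where
    lemma : ∀ x d → 2 * x * d ≡ x * (2 * d)
    lemma = ℕSolver.solve-∀

-- Since (2n)! is n! (n+1)! times the Catalan number, T(4,n) is that number times 840 /
-- ((n+2)(n+3)(n+4)), where 840 = 8! / (2 · 4!).
T-4 : ∀ n {x} → x * ((2 + n) * (3 + n) * (4 + n)) ≡ 840 * catalan n → T 4 n ≡ + x ℚ./ 1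
T-4 n {x} eq = ½-* {x} (4 ! * n ! * (4 + n) !) (begin-≡
  8 ! * (2 * n) !
    ≡⟨ cong (8 ! *_) (catalan-closed n) ⟨
  8 ! * (catalan n * (n ! * suc n !))
    ≡⟨ lemma₁ (catalan n) (n ! * suc n !) ⟩
  48 * ((840 * catalan n) * (n ! * suc n !))
    ≡⟨ cong (λ i → 48 * (i * (n ! * suc n !))) eq ⟨
  48 * (x * ((2 + n) * (3 + n) * (4 + n)) * (n ! * suc n !))
    ≡⟨ lemma₂ n x (n !) (suc n !) ⟩
  2 * x * (24 * n ! * ((4 + n) * ((3 + n) * ((2 + n) * suc n !)))) ∎-≡)
  where
  instance
    denominator≢0 : NonZero (4 ! * n ! * (4 + n) !)
    denominator≢0 = ℕ.m*n≢0 (4 ! * n !) ((4 + n) !)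
      {{ℕ.m*n≢0 (4 !) (n !) {{4 ℕ.!≢0}} {{n ℕ.!≢0}}}} {{(4 + n) ℕ.!≢0}}
  lemma₁ : ∀ c f → 40320 * (c * f) ≡ 48 * ((840 * c) * f)
  lemma₁ = ℕSolver.solve-∀
  lemma₂ : ∀ n x f g → 48 * (x * ((2 + n) * (3 + n) * (4 + n)) * (f * g)) ≡
    2 * x * (24 * f * ((4 + n) * ((3 + n) * ((2 + n) * g))))
  lemma₂ = ℕSolver.solve-∀

-- Comparison of coefficients and conclusion

G-neg : ∀ n m k → + G -[1+ n ] m k ≡ 0ℤ
G-neg n m k = trans (length-filter (admissible? -[1+ n ] m k) (tuples m (pathsUpTo L)))
  (count-none (admissible? -[1+ n ] m k) (λ πs → ⟦⟧-no (admissible? -[1+ n ] m k πs) λ { (_ , () , _) })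
    (tuples m (pathsUpTo L)))
  where
  L : ℕ
  L = ∣ + 2 ℤ.* -[1+ n ] ∣

-- Degree `2 + n * 2` stands for half-length `suc n`, and each factor X lowers that by one, which
-- yields the indices of the three terms. The common bound on h lies above `6 + n * 2`, the degree
-- at which `sum-is-superCatalan` replaces `bounded` by `dyck`.
sumBelow-coeff : ∀ n →
  sumBelow (9 + n * 2) (λ h → summand (bounded h) (bounded (1 + h)) (bounded (2 + h))) (2 + n * 2)
  ≡ + (G (+ suc n) 4 1 + 10 * G (+ suc n ℤ.- + 1) 4 0 + 4 * G (+ suc n ℤ.- + 2) 5 0)
sumBelow-coeff n = begin-≡
  sumBelow H (λ h → summand (bounded h) (bounded (1 + h)) (bounded (2 + h))) N
    ≡⟨ coeff (split H) N ⟩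
  (S₁ ⊕ const (+ 10) ⊛ (X ⊛ S₂) ⊕ const (+ 4) ⊛ (X ⊛ (X ⊛ S₃))) N
    ≡⟨ trans (⊕-coeff _ _ N) (cong₂ ℤ._+_
         (trans (⊕-coeff _ _ N) (cong (ℤ._+_ (S₁ N)) (const-⊛-coeff (+ 10) (X ⊛ S₂) N)))
         (const-⊛-coeff (+ 4) (X ⊛ (X ⊛ S₃)) N)) ⟩
  S₁ N ℤ.+ + 10 ℤ.* (X ⊛ S₂) N ℤ.+ + 4 ℤ.* (X ⊛ (X ⊛ S₃)) N
    ≡⟨ cong₂ ℤ._+_ (cong₂ (λ a b → a ℤ.+ + 10 ℤ.* b) (at (suc n) 3 1 (ℕ.m≤n+m _ 6))
         (trans (X-⊛-coeff S₂ (n * 2)) (at n 3 0 (ℕ.m≤n+m _ 8))))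
         (cong (ℤ._*_ (+ 4)) (third n (ℕ.m≤n+m _ 8))) ⟩
  + G₁ ℤ.+ + 10 ℤ.* + G₂ ℤ.+ + 4 ℤ.* + G₃
    ≡⟨ cong₂ (λ a b → + G₁ ℤ.+ a ℤ.+ b) (ℤ.pos-* 10 G₂) (ℤ.pos-* 4 G₃) ⟨
  + (G₁ + 10 * G₂ + 4 * G₃) ∎-≡
  where
  N H G₁ G₂ G₃ : ℕ
  N = 2 + n * 2
  H = 9 + n * 2
  G₁ = G (+ suc n) 4 1
  G₂ = G (+ suc n ℤ.- + 1) 4 0
  G₃ = G (+ suc n ℤ.- + 2) 5 0
  S₁ S₂ S₃ : Series
  S₁ = sumBelow H (windowSeries 4 1)
  S₂ = sumBelow H (windowSeries 4 0)
  S₃ = sumBelow H (windowSeries 5 0)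
  split : ∀ H → sumBelow H (λ h → summand (bounded h) (bounded (1 + h)) (bounded (2 + h))) ≈
    sumBelow H (windowSeries 4 1) ⊕ const (+ 10) ⊛ (X ⊛ sumBelow H (windowSeries 4 0))
      ⊕ const (+ 4) ⊛ (X ⊛ (X ⊛ sumBelow H (windowSeries 5 0)))
  split zero    = solve 1 (λ x → con 0ℤ :=
    con 0ℤ :+ con (+ 10) :* (x :* con 0ℤ) :+ con (+ 4) :* (x :* (x :* con 0ℤ))) 𝕊.refl X
  split (suc H) = 𝕊.trans (𝕊.+-congʳ (split H))
    (solve 7 (λ x a b c d e f →
        (a :+ con (+ 10) :* (x :* b) :+ con (+ 4) :* (x :* (x :* c)))
          :+ (d :+ con (+ 10) :* (x :* e) :+ con (+ 4) :* (x :* (x :* f)))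
        := (a :+ d) :+ con (+ 10) :* (x :* (b :+ e)) :+ con (+ 4) :* (x :* (x :* (c :+ f))))
      𝕊.refl X (sumBelow H (windowSeries 4 1)) (sumBelow H (windowSeries 4 0)) (sumBelow H (windowSeries 5 0))
        (windowSeries 4 1 H) (windowSeries 4 0 H) (windowSeries 5 0 H))
  at : ∀ n m k {H} → n * 2 ℕ.< H → sumBelow H (windowSeries (suc m) k) (n * 2) ≡ + G (+ n) (suc m) k
  at n m k {H} n<H = subst (λ N → sumBelow H (windowSeries (suc m) k) N ≡ + G (+ n) (suc m) k) (ℕ.*-comm 2 n)
    (sym (G-coeff n m k (subst (ℕ._< H) (ℕ.*-comm n 2) n<H)))
  third : ∀ n {H} → n * 2 ℕ.< H →
    (X ⊛ (X ⊛ sumBelow H (windowSeries 5 0))) (2 + n * 2) ≡ + G (+ suc n ℤ.- + 2) 5 0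
  -- Here the half-length is 1 and the index of the last term is -1: the factor X² leaves no
  -- coefficient in degree 2, and no tuple has negative length.
  third zero    {H} _   = trans (X-⊛-coeff (X ⊛ S) 0) (trans (X-⊛-coeff-0 S) (sym (G-neg 0 5 0)))
    where
    S = sumBelow H (windowSeries 5 0)
  third (suc n) {H} n<H = trans (X-⊛-coeff (X ⊛ S) (2 + n * 2)) (trans (X-⊛-coeff S (n * 2))
    (at n 4 0 (ℕ.<-trans (s≤s (ℕ.m≤n+m _ 1)) n<H)))
    where
    S = sumBelow H (windowSeries 5 0)

telescoped : ∀ H →
  X ⊛ (X ⊛ sumBelow H (λ h → summand (bounded h) (bounded (1 + h)) (bounded (2 + h))))
  ≈ potential (bounded H) (bounded (1 + H)) - potential (bounded 0) (bounded 1)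
telescoped zero    = solve 2 (λ x s → x :* (x :* con 0ℤ) := s :- s)
  𝕊.refl X (potential (bounded 0) (bounded 1))
telescoped (suc H) = 𝕊.trans
  (solve 3 (λ x s t → x :* (x :* (s :+ t)) := x :* (x :* s) :+ x :* (x :* t)) 𝕊.refl X _ _)
  (𝕊.trans (𝕊.+-cong (telescoped H)
      (summand-telescopes (bounded H) (bounded (1 + H)) (bounded (2 + H)) (bounded-rec H) (bounded-rec (suc H))))
    (solve 3 (λ s t u → (s :- t) :+ (u :- s) := u :- t) 𝕊.refl _ _ _))

potential-cong≤ : ∀ {b b′ a a′ N} → b ≈[ N ] b′ → a ≈[ N ] a′ →
  potential b a ≈[ N ] potential b′ a′
potential-cong≤ p q = ⊕-cong≤
  (⊕-cong≤ (⊕-cong≤ (⊛-cong≤ ≈[]-refl (^-cong≤ 3 q)) (⊛-cong≤ ≈[]-refl (^-cong≤ 2 q)))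
    (⊛-cong≤ ≈[]-refl q))
  (⊕-cong≤ (⊕-cong≤ (⊕-cong≤ (⊕-cong≤
    (⊛-cong≤ ≈[]-refl (^-cong≤ 5 p)) (⊖-cong≤ (⊛-cong≤ ≈[]-refl (^-cong≤ 4 p))))
    (⊛-cong≤ ≈[]-refl (^-cong≤ 3 p))) (⊖-cong≤ (⊛-cong≤ ≈[]-refl (^-cong≤ 2 p))))
    (⊛-cong≤ ≈[]-refl p))

bounded-1 : bounded 1 ≈ const 1ℤ
bounded-1 = 𝕊.trans (bounded-rec 0)
  (solve 2 (λ x b → con 1ℤ :+ x :* con 0ℤ :* b := con 1ℤ) 𝕊.refl X (bounded 1))

dyck-square : ∀ n → (dyck ⊛ dyck) n ≡ dyck (2 + n)
dyck-square n = sym (trans (coeff dyck-eq (2 + n)) (trans (⊕-coeff _ _ (2 + n))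
  (trans (ℤ.+-identityˡ _) (trans (coeff (𝕊.*-assoc X dyck dyck) (2 + n)) (X-⊛-coeff (dyck ⊛ dyck) n)))))

-- Multiplication by X² moves the coefficient to `N = 6 + n * 2`. Modulo z^(N+1) the upper end of
-- the telescoped sum is `potential dyck dyck`, and `catalan-limit` turns it into shifts of the
-- Catalan series.
sum-is-superCatalan : ∀ n →
  sumBelow (9 + n * 2) (λ h → summand (bounded h) (bounded (1 + h)) (bounded (2 + h))) (2 + n * 2)
  ≡ + 64 ℤ.* + catalan (1 + n) ℤ.- + 48 ℤ.* + catalan (2 + n) ℤ.+ + 12 ℤ.* + catalan (3 + n) ℤ.- + catalan (4 + n)
sum-is-superCatalan n = begin-≡
  S (2 + n * 2)
    ≡⟨ trans (X-⊛-coeff (X ⊛ S) (4 + n * 2)) (X-⊛-coeff S (2 + n * 2)) ⟨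
  (X ⊛ (X ⊛ S)) N
    ≡⟨ coeff (telescoped (9 + n * 2)) N ⟩
  (potential (bounded (9 + n * 2)) (bounded (10 + n * 2)) - potential (bounded 0) (bounded 1)) N
    ≡⟨ coeff≤ (⊕-cong≤
         (potential-cong≤ (bounded-limit (ℕ.m≤n+m _ 2)) (bounded-limit (ℕ.m≤n+m _ 3)))
         (⊖-cong≤ (potential-cong≤ {b = bounded 0} ≈[]-refl (≈⇒≈[] bounded-1)))) N ℕ.≤-refl ⟩
  (potential dyck dyck - potential (const 0ℤ) (const 1ℤ)) N
    ≡⟨ coeff (catalan-limit dyck dyck-eq) N ⟩
  (⊖ (dyck ⊛ dyck) ⊕ const (+ 12) ⊛ dyck ⊕ const -[1+ 47 ] ⊛ (X ⊛ dyck)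
      ⊕ const (+ 64) ⊛ (X ⊛ (X ⊛ dyck))
    ⊕ const -[1+ 10 ] ⊕ X ⊛ const (+ 38) ⊕ X ⊛ (X ⊛ const -[1+ 33 ])) N
    ≡⟨ terms-coeff ⟩
  ℤ.- (dyck (2 + N)) ℤ.+ + 12 ℤ.* dyck N ℤ.+ -[1+ 47 ] ℤ.* dyck (4 + n * 2)
    ℤ.+ + 64 ℤ.* dyck (2 + n * 2) ℤ.+ 0ℤ ℤ.+ 0ℤ ℤ.+ 0ℤ
    ≡⟨ lemma (dyck (2 + n * 2)) (dyck (4 + n * 2)) (dyck N) (dyck (2 + N)) ⟩
  _ ∎-≡
  where
  N : ℕ
  N = 6 + n * 2
  S : Series
  S = sumBelow (9 + n * 2) (λ h → summand (bounded h) (bounded (1 + h)) (bounded (2 + h)))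
  infixl 6 _⊞_
  _⊞_ : ∀ {f g a b} → f N ≡ a → g N ≡ b → (f ⊕ g) N ≡ a ℤ.+ b
  p ⊞ q = trans (⊕-coeff _ _ N) (cong₂ ℤ._+_ p q)
  const-coeff : ∀ c {f a} → f N ≡ a → (const c ⊛ f) N ≡ c ℤ.* a
  const-coeff c p = trans (const-⊛-coeff c _ N) (cong (ℤ._*_ c) p)
  terms-coeff : (⊖ (dyck ⊛ dyck) ⊕ const (+ 12) ⊛ dyck ⊕ const -[1+ 47 ] ⊛ (X ⊛ dyck)
      ⊕ const (+ 64) ⊛ (X ⊛ (X ⊛ dyck))
      ⊕ const -[1+ 10 ] ⊕ X ⊛ const (+ 38) ⊕ X ⊛ (X ⊛ const -[1+ 33 ])) N
    ≡ ℤ.- (dyck (2 + N)) ℤ.+ + 12 ℤ.* dyck N ℤ.+ -[1+ 47 ] ℤ.* dyck (4 + n * 2)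
      ℤ.+ + 64 ℤ.* dyck (2 + n * 2) ℤ.+ 0ℤ ℤ.+ 0ℤ ℤ.+ 0ℤ
  terms-coeff = trans (⊖-coeff _ N) (cong ℤ.-_ (dyck-square N))
    ⊞ const-coeff (+ 12) refl
    ⊞ const-coeff -[1+ 47 ] (X-⊛-coeff dyck (4 + n * 2))
    ⊞ const-coeff (+ 64) (trans (X-⊛-coeff (X ⊛ dyck) (4 + n * 2)) (X-⊛-coeff dyck (2 + n * 2)))
    -- The polynomial part lives in degrees 0, 2 and 4, all below `N`.
    ⊞ refl
    ⊞ X-⊛-coeff (const (+ 38)) (4 + n * 2)
    ⊞ trans (X-⊛-coeff (X ⊛ const -[1+ 33 ]) (4 + n * 2)) (X-⊛-coeff (const -[1+ 33 ]) (2 + n * 2))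
  lemma : ∀ a b c d → ℤ.- d ℤ.+ + 12 ℤ.* c ℤ.+ -[1+ 47 ] ℤ.* b ℤ.+ + 64 ℤ.* a ℤ.+ 0ℤ ℤ.+ 0ℤ ℤ.+ 0ℤ ≡
    + 64 ℤ.* a ℤ.- + 48 ℤ.* b ℤ.+ + 12 ℤ.* c ℤ.- d
  lemma = solve-∀

theorem2 : (n : ℕ) → 1 ≤ n →
    T 4 n ≡ + (G (+ n) 4 1 + 10 * G (+ n ℤ.- + 1) 4 0 + 4 * G (+ n ℤ.- + 2) 5 0) ℚ./ 1
theorem2 (suc n) _ = T-4 (suc n) {x} (superCatalan (suc n) {x}
  (trans (sym (sumBelow-coeff n)) (sum-is-superCatalan n)))
  where
  x : ℕ
  x = G (+ suc n) 4 1 + 10 * G (+ suc n ℤ.- + 1) 4 0 + 4 * G (+ suc n ℤ.- + 2) 5 0
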